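{- Let $G$ be a graph on $n$ vertices, let $g$ be a positive integer, and let $L=L(G,g)$ be the number of cycles of $G$ of length at most $g-1$. Let $q\geq 2$ and $w\geq 0$ be real numbers. Then $$Z^{(2)}_G(q,w)\leq Z_G(q,w)\leq q^{n/g+L}Z^{(2)}_G(q,w).$$
   Context: Graphs are finite. For a graph $G=(V,E)$, $$Z_G(q,w)=\sum_{A\subseteq E}q^{k(A)}w^{|A|},$$ where $k(A)$ is the number of connected components of $(V,A)$. The rank 2 approximation is $$Z^{(2)}_G(q,w)=\sum_{S\subseteq V}(1+w)^{e(S)}(q-1)^{v(G)-|S|}\left(1+\frac{w}{q-1}\right)^{e(G-S)},$$ where $v(G)=|V|$, $e(S)$ is the number of edges of $G$ with both endpoints in $S$, and $e(G-S)$ is the number of edges of $G$ with both endpoints in $V\setminus S$. -}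

module Defs where

open import Data.Nat.Base as ℕ using (ℕ; zero; suc; z≤n; s≤s)
import Data.Nat.Properties as ℕ
open import Data.Nat.DivMod using (_mod_)
open import Data.Integer.Base as ℤ using (+_; -[1+_])
import Data.Integer.Properties as ℤ
open import Data.Rational.Base as ℚ using (ℚ; 0ℚ; 1ℚ; ½; mkℚ)
import Data.Rational.Properties as ℚ
open import Data.Rational.Solver using (module +-*-Solver)
import Data.Rational.Unnormalised.Base as ℚᵘ
import Data.Rational.Unnormalised.Properties as ℚᵘ
open import Algebra.Definitions.RawSemiring ℚ.+-*-rawSemiring using () renaming (_^_ to _^ℚᴺ_)
open import Data.Fin.Base using (Fin; toℕ)
import Data.Fin.Properties as Fin
open import Data.List.Base as List using (List; []; _∷_; foldr; map; filter; length; allFin; cartesianProduct)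
import Data.List.Membership.Propositional as List
import Data.List.Membership.Propositional.Properties as List
open import Data.List.Relation.Unary.Any using (here; there)
open import Data.Vec.Base as Vec using (Vec; []; _∷_; lookup)
import Data.Vec.Membership.Propositional as Vec
open import Data.Vec.Relation.Unary.Any using () renaming (any? to anyVec?)
open import Data.Vec.Relation.Unary.AllPairs using (allPairs?)
open import Data.Vec.Relation.Unary.Unique.Propositional using (Unique)
open import Data.Product.Base using (∃; ∃-syntax; _×_; _,_; proj₁; proj₂)
open import Data.Product.Properties using (≡-dec)
open import Data.Sum.Base using (_⊎_; inj₁; inj₂)
open import Data.Empty using (⊥-elim)
open import Data.Bool.Base using (if_then_else_)
open import Function.Bundles using (_⇔_; mk⇔; Equivalence)
open import Relation.Nullary.Negation using (¬_)
open import Relation.Nullary.Decidable using (Dec; does; yes; no; map′; ¬?; _×-dec_; _⊎-dec_; _→-dec_)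
open import Relation.Unary using (Decidable)
open import Relation.Binary.Construct.Closure.ReflexiveTransitive using (Star; ε; _◅_; _◅◅_)
open import Relation.Binary.PropositionalEquality using (_≡_; refl; sym; trans; cong; cong₂; subst)

IsCauchy : (ℕ → ℚ) → Set
IsCauchy s = ∀ δ → 0ℚ ℚ.< δ → ∃[ N ] ∀ i j → N ℕ.≤ i → N ℕ.≤ j → ℚ.∣ s i ℚ.- s j ∣ ℚ.< δ

module Rational where
  open import Data.Rational.Base
  open ℚ.≤-Reasoning

  inv : (p : ℚ) → 0ℚ < p → ℚ
  inv p 0<p = (1/ p) {{>-nonZero 0<p}}

  *-inv : ∀ p 0<p → p * inv p 0<p ≡ 1ℚ
  *-inv p 0<p = ℚ.*-inverseʳ p {{>-nonZero 0<p}}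

  inv-pos : ∀ p 0<p → 0ℚ < inv p 0<p
  inv-pos p 0<p = ℚ.positive⁻¹ _ {{ℚ.1/pos⇒pos p {{positive 0<p}}}}

  *-pos : ∀ {p q} → 0ℚ < p → 0ℚ < q → 0ℚ < p * q
  *-pos {p} {q} 0<p 0<q = ℚ.positive⁻¹ _ {{ℚ.pos*pos⇒pos p {{positive 0<p}} q {{positive 0<q}}}}

  *-nonneg : ∀ {p q} → 0ℚ ≤ p → 0ℚ ≤ q → 0ℚ ≤ p * q
  *-nonneg {p} {q} 0≤p 0≤q =
    ℚ.nonNegative⁻¹ _ {{ℚ.nonNeg*nonNeg⇒nonNeg p {{nonNegative 0≤p}} q {{nonNegative 0≤q}}}}

  *-mono : ∀ {p q r s} → 0ℚ ≤ r → 0ℚ ≤ q → p ≤ q → r ≤ s → p * r ≤ q * s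
  *-mono {p} {q} {r} {s} 0≤r 0≤q p≤q r≤s = begin
    p * r  ≤⟨ ℚ.*-monoʳ-≤-nonNeg r {{nonNegative 0≤r}} p≤q ⟩
    q * r  ≤⟨ ℚ.*-monoˡ-≤-nonNeg q {{nonNegative 0≤q}} r≤s ⟩
    q * s  ∎

  *-monoˡ-< : ∀ {p q r} → 0ℚ < r → p < q → r * p < r * q
  *-monoˡ-< {r = r} 0<r = ℚ.*-monoʳ-<-pos r {{positive 0<r}}

  half-pos : ∀ {p} → 0ℚ < p → 0ℚ < ½ * p
  half-pos 0<p = *-pos (ℚ.positive⁻¹ ½) 0<p

  halves : ∀ p → ½ * p + ½ * p ≡ p
  halves p = trans (sym (ℚ.*-distribʳ-+ p ½ ½)) (ℚ.*-identityˡ p)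

  x≤∣x∣ : ∀ p → p ≤ ∣ p ∣
  x≤∣x∣ p with ℚ.≤-total 0ℚ p
  ... | inj₁ 0≤p = ℚ.≤-reflexive (sym (ℚ.0≤p⇒∣p∣≡p 0≤p))
  ... | inj₂ p≤0 = ℚ.≤-trans p≤0 (ℚ.0≤∣p∣ p)

  ∣-∣-swap : ∀ p q → ∣ p - q ∣ ≡ ∣ q - p ∣
  ∣-∣-swap p q = trans (sym (ℚ.∣-p∣≡∣p∣ (p - q)))
    (cong ∣_∣ (solve 2 (λ p q → :- (p :- q) := q :- p) refl p q))
    where open +-*-Solver

  ∣-∣<⇒<+ : ∀ {p q e} → ∣ p - q ∣ < e → p < q + e
  ∣-∣<⇒<+ {p} {q} {e} h = begin-strict
    p            ≡⟨ solve 2 (λ p q → p := q :+ (p :- q)) refl p q ⟩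
    q + (p - q)  ≤⟨ ℚ.+-monoʳ-≤ q (x≤∣x∣ (p - q)) ⟩
    q + ∣ p - q ∣ <⟨ ℚ.+-monoʳ-< q h ⟩
    q + e        ∎
    where open +-*-Solver

  <+⇒∣-∣< : ∀ {p q e} → p < q + e → q < p + e → ∣ p - q ∣ < e
  <+⇒∣-∣< {p} {q} {e} p<q+e q<p+e with ℚ.∣p∣≡p∨∣p∣≡-p (p - q)
  ... | inj₁ eq = begin-strict
    ∣ p - q ∣     ≡⟨ eq ⟩
    p - q         <⟨ ℚ.+-monoˡ-< (- q) p<q+e ⟩
    (q + e) - q   ≡⟨ solve 2 (λ q e → (q :+ e) :- q := e) refl q e ⟩
    e             ∎
    where open +-*-Solver
  ... | inj₂ eq = begin-strict
    ∣ p - q ∣     ≡⟨ eq ⟩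
    - (p - q)     ≡⟨ solve 2 (λ p q → :- (p :- q) := q :- p) refl p q ⟩
    q - p         <⟨ ℚ.+-monoˡ-< (- p) q<p+e ⟩
    (p + e) - p   ≡⟨ solve 2 (λ p e → (p :+ e) :- p := e) refl p e ⟩
    e             ∎
    where open +-*-Solver

  grid : ℕ → ℕ → ℚ
  grid d j = + j / suc d

  grid-+ : ∀ d i j → grid d (i ℕ.+ j) ≡ grid d i + grid d j
  grid-+ d i j = ℚ.toℚᵘ-injective (ℚᵘ.≃-trans (ℚ.toℚᵘ-fromℚᵘ (ℚᵘ.mkℚᵘ (+ (i ℕ.+ j)) d))
    (ℚᵘ.≃-trans same (ℚᵘ.≃-trans (ℚᵘ.≃-sym (ℚᵘ.+-cong (ℚ.toℚᵘ-fromℚᵘ (ℚᵘ.mkℚᵘ (+ i) d)) (ℚ.toℚᵘ-fromℚᵘ (ℚᵘ.mkℚᵘ (+ j) d))))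
      (ℚᵘ.≃-sym (ℚ.toℚᵘ-homo-+ (grid d i) (grid d j))))))
    where
    D = + suc d
    same : ℚᵘ.mkℚᵘ (+ (i ℕ.+ j)) d ℚᵘ.≃ ℚᵘ.mkℚᵘ (+ i) d ℚᵘ.+ ℚᵘ.mkℚᵘ (+ j) d
    same = ℚᵘ.*≡* (trans (sym (ℤ.*-assoc (+ (i ℕ.+ j)) D D)) (cong (ℤ._* D) (ℤ.*-distribʳ-+ D (+ i) (+ j))))

  0≤grid : ∀ d j → 0ℚ ≤ grid d j
  0≤grid d j = ℚ.toℚᵘ-cancel-≤ (ℚᵘ.≤-trans (ℚᵘ.nonNegative⁻¹ (ℚᵘ.mkℚᵘ (+ j) d))
                                 (ℚᵘ.≤-reflexive (ℚᵘ.≃-sym (ℚ.toℚᵘ-fromℚᵘ (ℚᵘ.mkℚᵘ (+ j) d)))))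

  grid-zero : ∀ d → grid d 0 ≡ 0ℚ
  grid-zero d = ℚ.0/n≡0 (suc d)

  step-small : ∀ p → 0ℚ < p → ∃[ N ] ∀ i → N ℕ.≤ i → grid i 1 ≤ p
  step-small p@(mkℚ (+ 0) d _) 0<p = ⊥-elim (ℚ.<-irrefl (sym (ℚ.↥p≡0⇒p≡0 p refl)) 0<p)
  step-small p@(mkℚ -[1+ n ] d _) (*<* ())
  step-small p@(mkℚ (+ suc n) d _) 0<p = d , λ i d≤i → ℚ.toℚᵘ-cancel-≤
    (ℚᵘ.≤-trans (ℚᵘ.≤-reflexive (ℚ.toℚᵘ-fromℚᵘ (ℚᵘ.mkℚᵘ (+ 1) i)))
      (ℚᵘ.*≤* (ℤ.+≤+ (ℕ.*-mono-≤ {1} {suc n} {suc d} {suc i} (s≤s z≤n) (s≤s d≤i)))))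

  bound : ℚ → ℕ → ℕ
  bound y d = suc ℤ.∣ ↥ y ∣ ℕ.* suc d

  grid-suc-bound : ∀ y d → (y < grid d (suc (bound y d))) × (1ℚ ≤ grid d (suc (bound y d)))
  grid-suc-bound y@(mkℚ a b _) d = ℚ.toℚᵘ-cancel-< (ℚᵘ.<-≤-trans lt eq) , ℚ.toℚᵘ-cancel-≤ (ℚᵘ.≤-trans le eq)
    where
    f = suc (bound y d)
    eq : ℚᵘ.mkℚᵘ (+ f) d ℚᵘ.≤ toℚᵘ (grid d f)
    eq = ℚᵘ.≤-reflexive (ℚᵘ.≃-sym (ℚ.toℚᵘ-fromℚᵘ (ℚᵘ.mkℚᵘ (+ f) d)))
    i≤∣i∣ : ∀ i → i ℤ.≤ + ℤ.∣ i ∣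
    i≤∣i∣ (+ n) = ℤ.≤-refl
    i≤∣i∣ -[1+ n ] = ℤ.-≤+
    nat : ℤ.∣ a ∣ ℕ.* suc d ℕ.< f ℕ.* suc b
    nat = ℕ.≤-trans (s≤s (ℕ.m≤n+m (ℤ.∣ a ∣ ℕ.* suc d) (suc d))) (ℕ.m≤m*n f (suc b))
    lt : ℚᵘ.mkℚᵘ a b ℚᵘ.< ℚᵘ.mkℚᵘ (+ f) d
    lt = ℚᵘ.*<* (ℤ.≤-<-trans (ℤ.*-monoʳ-≤-nonNeg (+ suc d) (i≤∣i∣ a))
           (subst (ℤ._< + f ℤ.* + suc b) (ℤ.pos-* ℤ.∣ a ∣ (suc d))
             (subst (+ (ℤ.∣ a ∣ ℕ.* suc d) ℤ.<_) (ℤ.pos-* f (suc b)) (ℤ.+<+ nat))))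
    le : ℚᵘ.1ℚᵘ ℚᵘ.≤ ℚᵘ.mkℚᵘ (+ f) d
    le = ℚᵘ.*≤* (ℤ.≤-trans (ℤ.≤-reflexive (ℤ.*-identityˡ (+ suc d)))
           (ℤ.≤-trans (ℤ.+≤+ (ℕ.≤-trans (ℕ.m≤m+n (suc d) (ℤ.∣ a ∣ ℕ.* suc d)) (ℕ.n≤1+n _)))
             (ℤ.≤-reflexive (sym (ℤ.*-identityʳ (+ f))))))

  ^-nonneg : ∀ {p} k → 0ℚ ≤ p → 0ℚ ≤ p ^ℚᴺ k
  ^-nonneg zero 0≤p = ℚ.nonNegative⁻¹ 1ℚ
  ^-nonneg (suc k) 0≤p = *-nonneg 0≤p (^-nonneg k 0≤p)

  ^-pos : ∀ {p} k → 0ℚ < p → 0ℚ < p ^ℚᴺ k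
  ^-pos zero 0<p = ℚ.positive⁻¹ 1ℚ
  ^-pos (suc k) 0<p = *-pos 0<p (^-pos k 0<p)

  ^-mono : ∀ {p q} k → 0ℚ ≤ p → p ≤ q → p ^ℚᴺ k ≤ q ^ℚᴺ k
  ^-mono zero 0≤p p≤q = ℚ.≤-refl
  ^-mono (suc k) 0≤p p≤q = *-mono (^-nonneg k 0≤p) (ℚ.≤-trans 0≤p p≤q) p≤q (^-mono k 0≤p p≤q)

  1≤^ : ∀ {p} k → 1ℚ ≤ p → 1ℚ ≤ p ^ℚᴺ k
  1≤^ zero 1≤p = ℚ.≤-refl
  1≤^ {p} (suc k) 1≤p = begin
    1ℚ * 1ℚ     ≤⟨ *-mono (ℚ.nonNegative⁻¹ 1ℚ) (ℚ.≤-trans (ℚ.nonNegative⁻¹ 1ℚ) 1≤p) 1≤p (1≤^ k 1≤p) ⟩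
    p * p ^ℚᴺ k ∎

  p≤p^1+k : ∀ {p} k → 1ℚ ≤ p → p ≤ p ^ℚᴺ suc k
  p≤p^1+k {p} k 1≤p = begin
    p           ≡⟨ ℚ.*-identityʳ p ⟨
    p * 1ℚ      ≤⟨ *-mono (ℚ.nonNegative⁻¹ 1ℚ) (ℚ.≤-trans (ℚ.nonNegative⁻¹ 1ℚ) 1≤p) (ℚ.≤-refl {p}) (1≤^ k 1≤p) ⟩
    p * p ^ℚᴺ k ∎

  ^-superadditive : ∀ {s t} k → 0ℚ ≤ s → 0ℚ ≤ t → s ^ℚᴺ suc k + t ^ℚᴺ suc k ≤ (s + t) ^ℚᴺ suc k
  ^-superadditive {s} {t} k 0≤s 0≤t = begin
    s * s ^ℚᴺ k + t * t ^ℚᴺ k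
      ≤⟨ ℚ.+-mono-≤ (ℚ.*-monoˡ-≤-nonNeg s {{nonNegative 0≤s}} (^-mono k 0≤s s≤s+t))
                    (ℚ.*-monoˡ-≤-nonNeg t {{nonNegative 0≤t}} (^-mono k 0≤t t≤s+t)) ⟩
    s * (s + t) ^ℚᴺ k + t * (s + t) ^ℚᴺ k
      ≡⟨ ℚ.*-distribʳ-+ ((s + t) ^ℚᴺ k) s t ⟨
    (s + t) * (s + t) ^ℚᴺ k ∎
    where
    s≤s+t : s ≤ s + t
    s≤s+t = subst (_≤ s + t) (ℚ.+-identityʳ s) (ℚ.+-monoʳ-≤ s 0≤t)
    t≤s+t : t ≤ s + t
    t≤s+t = subst (_≤ s + t) (ℚ.+-identityˡ t) (ℚ.+-monoˡ-≤ t 0≤s)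


  ⊔-left : ∀ a b {i} → a ℕ.⊔ b ℕ.≤ i → a ℕ.≤ i
  ⊔-left a b = ℕ.≤-trans (ℕ.m≤m⊔n a b)

  ⊔-right : ∀ a b {i} → a ℕ.⊔ b ℕ.≤ i → b ℕ.≤ i
  ⊔-right a b = ℕ.≤-trans (ℕ.m≤n⊔m a b)

  +-cauchy : ∀ {s t} → IsCauchy s → IsCauchy t → IsCauchy (λ i → s i + t i)
  +-cauchy {s} {t} cs ct δ 0<δ with cs (½ * δ) (half-pos 0<δ) | ct (½ * δ) (half-pos 0<δ)
  ... | M , hM | N , hN = M ℕ.⊔ N , λ i j mi mj → begin-strict
    ∣ (s i + t i) - (s j + t j) ∣
      ≡⟨ cong ∣_∣ (solve 4 (λ a b c d → (a :+ b) :- (c :+ d) := (a :- c) :+ (b :- d)) refl (s i) (t i) (s j) (t j)) ⟩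
    ∣ (s i - s j) + (t i - t j) ∣  ≤⟨ ℚ.∣p+q∣≤∣p∣+∣q∣ (s i - s j) (t i - t j) ⟩
    ∣ s i - s j ∣ + ∣ t i - t j ∣
      <⟨ ℚ.+-mono-< (hM i j (⊔-left M N mi) (⊔-left M N mj)) (hN i j (⊔-right M N mi) (⊔-right M N mj)) ⟩
    ½ * δ + ½ * δ                  ≡⟨ halves δ ⟩
    δ ∎
    where open +-*-Solver

  neg-cauchy : ∀ {s} → IsCauchy s → IsCauchy (λ i → - s i)
  neg-cauchy {s} cs δ 0<δ with cs δ 0<δ
  ... | N , h = N , λ i j mi mj → subst (_< δ)
    (trans (sym (ℚ.∣-p∣≡∣p∣ (s i - s j)))
      (cong ∣_∣ (solve 2 (λ a b → :- (a :- b) := (:- a) :- (:- b)) refl (s i) (s j)))) (h i j mi mj)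
    where open +-*-Solver

  eventually-bounded : ∀ {s} → IsCauchy s → ∃[ B ] 0ℚ < B × ∃[ N ] ∀ i → N ℕ.≤ i → ∣ s i ∣ ≤ B
  eventually-bounded {s} cs with cs 1ℚ (ℚ.positive⁻¹ 1ℚ)
  ... | N , h = 1ℚ + ∣ s N ∣ , 0<B , N , λ i Ni → begin
    ∣ s i ∣                     ≡⟨ cong ∣_∣ (solve 2 (λ a b → a := (a :- b) :+ b) refl (s i) (s N)) ⟩
    ∣ (s i - s N) + s N ∣       ≤⟨ ℚ.∣p+q∣≤∣p∣+∣q∣ (s i - s N) (s N) ⟩
    ∣ s i - s N ∣ + ∣ s N ∣     ≤⟨ ℚ.+-monoˡ-≤ ∣ s N ∣ (ℚ.<⇒≤ (h i N Ni ℕ.≤-refl)) ⟩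
    1ℚ + ∣ s N ∣                ∎
    where
    open +-*-Solver
    0<B : 0ℚ < 1ℚ + ∣ s N ∣
    0<B = begin-strict
      0ℚ            <⟨ ℚ.positive⁻¹ 1ℚ ⟩
      1ℚ            ≡⟨ ℚ.+-identityʳ 1ℚ ⟨
      1ℚ + 0ℚ       ≤⟨ ℚ.+-monoʳ-≤ 1ℚ (ℚ.0≤∣p∣ (s N)) ⟩
      1ℚ + ∣ s N ∣  ∎

  -- Polynomial identities are stated for variables: the solver is slow on compound arguments.
  scaled : ∀ {b c} d → b * c ≡ 1ℚ → b * (d * c) ≡ d
  scaled {b} {c} d bc≡1 = trans (swap b c d) (trans (cong (d *_) bc≡1) (ℚ.*-identityʳ d))
    where
    open +-*-Solver
    swap : ∀ b c d → b * (d * c) ≡ d * (b * c)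
    swap = solve 3 (λ b c d → b :* (d :* c) := d :* (b :* c)) refl

  *-difference : ∀ a b c d → a * b - c * d ≡ a * (b - d) + d * (a - c)
  *-difference = solve 4 (λ a b c d → a :* b :- c :* d := a :* (b :- d) :+ d :* (a :- c)) refl
    where open +-*-Solver

  *-close : ∀ {a b c d B C e f} → 0ℚ < B → 0ℚ < C → ∣ a ∣ ≤ B → ∣ d ∣ ≤ C →
            ∣ b - d ∣ < e → ∣ a - c ∣ < f → ∣ a * b - c * d ∣ < B * e + C * f
  *-close {a} {b} {c} {d} {B} {C} {e} {f} 0<B 0<C a≤B d≤C b-d<e a-c<f = begin-strict
    ∣ a * b - c * d ∣                          ≡⟨ cong ∣_∣ (*-difference a b c d) ⟩
    ∣ a * (b - d) + d * (a - c) ∣              ≤⟨ ℚ.∣p+q∣≤∣p∣+∣q∣ (a * (b - d)) (d * (a - c)) ⟩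
    ∣ a * (b - d) ∣ + ∣ d * (a - c) ∣          ≡⟨ cong₂ _+_ (ℚ.∣p*q∣≡∣p∣*∣q∣ a (b - d)) (ℚ.∣p*q∣≡∣p∣*∣q∣ d (a - c)) ⟩
    ∣ a ∣ * ∣ b - d ∣ + ∣ d ∣ * ∣ a - c ∣
      ≤⟨ ℚ.+-mono-≤ (ℚ.*-monoʳ-≤-nonNeg ∣ b - d ∣ {{ℚ.∣-∣-nonNeg (b - d)}} a≤B)
                    (ℚ.*-monoʳ-≤-nonNeg ∣ a - c ∣ {{ℚ.∣-∣-nonNeg (a - c)}} d≤C) ⟩
    B * ∣ b - d ∣ + C * ∣ a - c ∣
      <⟨ ℚ.+-mono-< (*-monoˡ-< {∣ b - d ∣} {e} {B} 0<B b-d<e) (*-monoˡ-< {∣ a - c ∣} {f} {C} 0<C a-c<f) ⟩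
    B * e + C * f                              ∎

  *-cauchy : ∀ {s t} → IsCauchy s → IsCauchy t → IsCauchy (λ i → s i * t i)
  *-cauchy {s} {t} cs ct δ 0<δ =
    let B , 0<B , K , hK = eventually-bounded cs
        C , 0<C , L , hL = eventually-bounded ct
        M , hM = cs (½ * δ * inv C 0<C) (*-pos (half-pos 0<δ) (inv-pos C 0<C))
        N , hN = ct (½ * δ * inv B 0<B) (*-pos (half-pos 0<δ) (inv-pos B 0<B))
        KL = K ℕ.⊔ L
        MN = M ℕ.⊔ N
    in KL ℕ.⊔ MN , λ i j mi mj → subst (∣ s i * t i - s j * t j ∣ <_)
      (trans (cong₂ _+_ (scaled {B} (½ * δ) (*-inv B 0<B)) (scaled {C} (½ * δ) (*-inv C 0<C))) (halves δ))
      (*-close {s i} {t i} {s j} {t j} 0<B 0<C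
        (hK i (⊔-left K L (⊔-left KL MN mi))) (hL j (⊔-right K L (⊔-left KL MN mj)))
        (hN i j (⊔-right M N (⊔-right KL MN mi)) (⊔-right M N (⊔-right KL MN mj)))
        (hM i j (⊔-left M N (⊔-right KL MN mi)) (⊔-left M N (⊔-right KL MN mj))))

  inv-antitone : ∀ {p q} 0<p 0<q → p ≤ q → inv q 0<q ≤ inv p 0<p
  inv-antitone {p} {q} 0<p 0<q p≤q = begin
    q⁻¹                ≡⟨ ℚ.*-identityʳ q⁻¹ ⟨
    q⁻¹ * 1ℚ           ≡⟨ cong (q⁻¹ *_) (*-inv p 0<p) ⟨
    q⁻¹ * (p * p⁻¹)    ≤⟨ ℚ.*-monoˡ-≤-nonNeg q⁻¹ {{nonNegative (ℚ.<⇒≤ (inv-pos q 0<q))}}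
                           (ℚ.*-monoʳ-≤-nonNeg p⁻¹ {{nonNegative (ℚ.<⇒≤ (inv-pos p 0<p))}} p≤q) ⟩
    q⁻¹ * (q * p⁻¹)    ≡⟨ solve 3 (λ a b c → a :* (b :* c) := (b :* a) :* c) refl q⁻¹ q p⁻¹ ⟩
    (q * q⁻¹) * p⁻¹    ≡⟨ cong (_* p⁻¹) (*-inv q 0<q) ⟩
    1ℚ * p⁻¹           ≡⟨ ℚ.*-identityˡ p⁻¹ ⟩
    p⁻¹                ∎
    where
    open +-*-Solver
    p⁻¹ = inv p 0<p
    q⁻¹ = inv q 0<q

  inv-difference : ∀ a b 0<a 0<b → inv a 0<a - inv b 0<b ≡ (b - a) * (inv a 0<a * inv b 0<b)
  inv-difference a b 0<a 0<b = begin-equality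
    x - y                          ≡⟨ cong₂ _-_ (ℚ.*-identityˡ x) (ℚ.*-identityˡ y) ⟨
    1ℚ * x - 1ℚ * y                ≡⟨ cong₂ (λ u v → u * x - v * y) (*-inv b 0<b) (*-inv a 0<a) ⟨
    b * y * x - a * x * y
      ≡⟨ solve 4 (λ a b x y → b :* y :* x :- a :* x :* y := (b :- a) :* (x :* y)) refl a b x y ⟩
    (b - a) * (x * y)              ∎
    where
    open +-*-Solver
    x = inv a 0<a
    y = inv b 0<b

  inv-cauchy : ∀ {s} → IsCauchy s → ∀ {c} → 0ℚ < c → (∀ i → c ≤ s i) →
               (0<s : ∀ i → 0ℚ < s i) → IsCauchy (λ i → inv (s i) (0<s i))
  inv-cauchy {s} cs {c} 0<c c≤s 0<s δ 0<δ with cs (δ * (c * c)) (*-pos 0<δ (*-pos 0<c 0<c))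
  ... | N , h = N , λ i j mi mj → let x = inv (s i) (0<s i); y = inv (s j) (0<s j)
                                      0≤xy = ℚ.<⇒≤ (*-pos (inv-pos (s i) (0<s i)) (inv-pos (s j) (0<s j))) in
    begin-strict
    ∣ x - y ∣                            ≡⟨ cong ∣_∣ (inv-difference (s i) (s j) (0<s i) (0<s j)) ⟩
    ∣ (s j - s i) * (x * y) ∣            ≡⟨ ℚ.∣p*q∣≡∣p∣*∣q∣ (s j - s i) (x * y) ⟩
    ∣ s j - s i ∣ * ∣ x * y ∣            ≡⟨ cong (∣ s j - s i ∣ *_) (ℚ.0≤p⇒∣p∣≡p 0≤xy) ⟩
    ∣ s j - s i ∣ * (x * y)
      ≤⟨ ℚ.*-monoˡ-≤-nonNeg ∣ s j - s i ∣ {{ℚ.∣-∣-nonNeg (s j - s i)}}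
           (*-mono (ℚ.<⇒≤ (inv-pos (s j) (0<s j))) (ℚ.<⇒≤ (inv-pos c 0<c))
             (inv-antitone 0<c (0<s i) (c≤s i)) (inv-antitone 0<c (0<s j) (c≤s j))) ⟩
    ∣ s j - s i ∣ * (c⁻¹ * c⁻¹)
      <⟨ ℚ.*-monoˡ-<-pos (c⁻¹ * c⁻¹) {{positive (*-pos (inv-pos c 0<c) (inv-pos c 0<c))}} (h j i mj mi) ⟩
    δ * (c * c) * (c⁻¹ * c⁻¹)
      ≡⟨ solve 3 (λ d c k → d :* (c :* c) :* (k :* k) := d :* ((c :* k) :* (c :* k))) refl δ c c⁻¹ ⟩
    δ * ((c * c⁻¹) * (c * c⁻¹))          ≡⟨ cong (λ u → δ * (u * u)) (*-inv c 0<c) ⟩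
    δ * 1ℚ                               ≡⟨ ℚ.*-identityʳ δ ⟩
    δ                                    ∎
    where
    open +-*-Solver
    c⁻¹ = inv c 0<c

  -- rootNum k y d f is the largest j ≤ f with j = 0 or (j / (d + 1)) ^ k ≤ y.
  rootNum : ℕ → ℚ → ℕ → ℕ → ℕ
  rootNum k y d zero = 0
  rootNum k y d (suc f) = if does (grid d (suc f) ^ℚᴺ k ℚ.≤? y) then suc f else rootNum k y d f

  -- For y ≥ 0 this is the k-th root of y rounded down to a multiple of
  -- 1 / (d + 1); for y < 0 it is 0.
  approxRoot : ℕ → ℚ → ℕ → ℚ
  approxRoot k y d = grid d (rootNum k y d (bound y d))


  if-does : ∀ {A : Set} (P : ℕ → Set) (a? : Dec A) {m n} →
            (A → P m) → (¬ A → P n) → P (if does a? then m else n)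
  if-does P (yes a) f g = f a
  if-does P (no ¬a) f g = g ¬a

  rootNum-lower : ∀ k y d f → rootNum k y d f ≡ 0 ⊎ grid d (rootNum k y d f) ^ℚᴺ k ≤ y
  rootNum-lower k y d zero    = inj₁ refl
  rootNum-lower k y d (suc f) = if-does (λ j → j ≡ 0 ⊎ grid d j ^ℚᴺ k ≤ y) (grid d (suc f) ^ℚᴺ k ℚ.≤? y)
    inj₂ (λ _ → rootNum-lower k y d f)

  rootNum-upper : ∀ k y d f → y < grid d (suc f) ^ℚᴺ k → y < grid d (suc (rootNum k y d f)) ^ℚᴺ k
  rootNum-upper k y d zero    h = h
  rootNum-upper k y d (suc f) h = if-does (λ j → y < grid d (suc j) ^ℚᴺ k) (grid d (suc f) ^ℚᴺ k ℚ.≤? y)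
    (λ _ → h) (λ gt → rootNum-upper k y d f (ℚ.≰⇒> gt))

  grid-rootNum-lower : ∀ k y d f → 0ℚ < grid d (rootNum k y d f) → grid d (rootNum k y d f) ^ℚᴺ k ≤ y
  grid-rootNum-lower k y d f 0<r with rootNum-lower k y d f
  ... | inj₁ eq = ⊥-elim (ℚ.<-irrefl (sym (trans (cong (grid d) eq) (grid-zero d))) 0<r)
  ... | inj₂ p  = p

  grid-rootNum-upper : ∀ k y d f → y < grid d (suc f) → 1ℚ ≤ grid d (suc f) →
                       y < (grid d (rootNum (suc k) y d f) + grid d 1) ^ℚᴺ suc k
  grid-rootNum-upper k y d f y<g 1≤g = subst (λ z → y < z ^ℚᴺ suc k)
    (trans (grid-+ d 1 r) (ℚ.+-comm (grid d 1) (grid d r)))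
    (rootNum-upper (suc k) y d f (ℚ.<-≤-trans y<g (p≤p^1+k k 1≤g)))
    where r = rootNum (suc k) y d f

  approxRoot-lower : ∀ k y d → 0ℚ < approxRoot k y d → approxRoot k y d ^ℚᴺ k ≤ y
  approxRoot-lower k y d = grid-rootNum-lower k y d (bound y d)

  approxRoot-upper : ∀ k y d → y < (approxRoot (suc k) y d + grid d 1) ^ℚᴺ suc k
  approxRoot-upper k y d = grid-rootNum-upper k y d (bound y d) (proj₁ (grid-suc-bound y d)) (proj₂ (grid-suc-bound y d))

  root-close : ∀ k {x y r t h η} → 0ℚ < η → 0ℚ ≤ t → 0ℚ ≤ h → h ≤ η →
               (0ℚ < r → r ^ℚᴺ suc k ≤ x) → y < (t + h) ^ℚᴺ suc k →
               ∣ x - y ∣ < η ^ℚᴺ suc k → r < t + (η + η)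
  root-close k {x} {y} {r} {t} {h} {η} 0<η 0≤t 0≤h h≤η lower upper x-y<η^k = ℚ.≰⇒> λ t+2η≤r →
    let 0≤t+h = ℚ.+-mono-≤ {0ℚ} {t} {0ℚ} {h} 0≤t 0≤h
        0<t+2η = ℚ.+-mono-≤-< {0ℚ} {t} {0ℚ} {η + η} 0≤t (ℚ.+-mono-< {0ℚ} {η} {0ℚ} {η} 0<η 0<η)
        sum≤r = begin
          t + h + η    ≤⟨ ℚ.+-monoˡ-≤ η (ℚ.+-monoʳ-≤ t h≤η) ⟩
          t + η + η    ≡⟨ ℚ.+-assoc t η η ⟩
          t + (η + η)  ≤⟨ t+2η≤r ⟩
          r            ∎
    in ℚ.<-irrefl refl (begin-strict
      x                              <⟨ ∣-∣<⇒<+ x-y<η^k ⟩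
      y + η ^ℚᴺ suc k                <⟨ ℚ.+-monoˡ-< (η ^ℚᴺ suc k) upper ⟩
      (t + h) ^ℚᴺ suc k + η ^ℚᴺ suc k  ≤⟨ ^-superadditive k 0≤t+h (ℚ.<⇒≤ 0<η) ⟩
      (t + h + η) ^ℚᴺ suc k
        ≤⟨ ^-mono (suc k) (ℚ.+-mono-≤ {0ℚ} {t + h} {0ℚ} {η} 0≤t+h (ℚ.<⇒≤ 0<η)) sum≤r ⟩
      r ^ℚᴺ suc k                    ≤⟨ lower (ℚ.<-≤-trans 0<t+2η t+2η≤r) ⟩
      x                              ∎)

  root-cauchy : ∀ k {s} → IsCauchy s → IsCauchy (λ i → approxRoot (suc k) (s i) i)
  root-cauchy k {s} cs δ 0<δ =
    let M , hM = cs ((½ * δ) ^ℚᴺ suc k) (^-pos (suc k) (half-pos 0<δ))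
        N , hN = step-small (½ * δ) (half-pos 0<δ)
        r : ℕ → ℚ
        r i = approxRoot (suc k) (s i) i
        close : ∀ i j → M ℕ.⊔ N ℕ.≤ i → M ℕ.⊔ N ℕ.≤ j → r i < r j + δ
        close i j mi mj = subst (λ e → r i < r j + e) (halves δ)
          (root-close k {s i} {s j} {r i} {r j} {grid j 1} {½ * δ} (half-pos 0<δ)
            (0≤grid j (rootNum (suc k) (s j) j (bound (s j) j))) (0≤grid j 1) (hN j (⊔-right M N mj))
            (approxRoot-lower (suc k) (s i) i) (approxRoot-upper k (s j) j)
            (hM i j (⊔-left M N mi) (⊔-left M N mj)))
    in M ℕ.⊔ N , λ i j mi mj → <+⇒∣-∣< (close i j mi mj) (close j i mj mi)

open Rational using (inv; inv-cauchy; +-cauchy; neg-cauchy; *-cauchy; approxRoot; root-cauchy)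

record ℝ : Set where
  constructor mkℝ
  field
    seq    : ℕ → ℚ
    cauchy : IsCauchy seq

open ℝ public

infix 4 _≤_ _<_
infixl 6 _+_ _-_
infixl 7 _*_
infixr 8 _^_

-- Different sequences may represent the same real: x and y are equal as reals
-- when x ≤ y and y ≤ x.
_≤_ : ℝ → ℝ → Set
x ≤ y = ∀ δ → 0ℚ ℚ.< δ → ∃[ N ] ∀ i → N ℕ.≤ i → seq x i ℚ.≤ seq y i ℚ.+ δ

_<_ : ℝ → ℝ → Set
x < y = ∃[ δ ] 0ℚ ℚ.< δ × ∃[ N ] ∀ i → N ℕ.≤ i → seq x i ℚ.+ δ ℚ.≤ seq y i

fromℚ : ℚ → ℝ
fromℚ p = mkℝ (λ _ → p) λ δ 0<δ → 0 , λ _ _ _ _ →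
  subst (λ z → ℚ.∣ z ∣ ℚ.< δ) (sym (ℚ.+-inverseʳ p)) 0<δ

0ℝ 1ℝ 2ℝ : ℝ
0ℝ = fromℚ 0ℚ
1ℝ = fromℚ 1ℚ
2ℝ = fromℚ (+ 2 ℚ./ 1)

_+_ _-_ _*_ : ℝ → ℝ → ℝ
x + y = mkℝ (λ i → seq x i ℚ.+ seq y i) (+-cauchy {seq x} {seq y} (cauchy x) (cauchy y))
x - y = mkℝ (λ i → seq x i ℚ.- seq y i) (+-cauchy {seq x} (cauchy x) (neg-cauchy {seq y} (cauchy y)))
x * y = mkℝ (λ i → seq x i ℚ.* seq y i) (*-cauchy {seq x} {seq y} (cauchy x) (cauchy y))

_^_ : ℝ → ℕ → ℝ
x ^ zero  = 1ℝ
x ^ suc k = x * x ^ k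

-- The positivity proof says from which index N on the terms are bounded away
-- from 0, so that they can be inverted; the first N terms are dropped.
recip : (x : ℝ) → 0ℝ < x → ℝ
recip x (c , 0<c , N , h) = mkℝ (λ i → inv (s i) (0<s i)) (inv-cauchy {s} shifted 0<c c≤s 0<s)
  where
  s : ℕ → ℚ
  s i = seq x (N ℕ.+ i)
  c≤s : ∀ i → c ℚ.≤ s i
  c≤s i = subst (ℚ._≤ s i) (ℚ.+-identityˡ c) (h (N ℕ.+ i) (ℕ.m≤m+n N i))
  0<s : ∀ i → 0ℚ ℚ.< s i
  0<s i = ℚ.<-≤-trans 0<c (c≤s i)
  shifted : IsCauchy s
  shifted δ 0<δ with cauchy x δ 0<δ
  ... | M , g = M , λ i j mi mj → g _ _ (ℕ.≤-trans mi (ℕ.m≤n+m i N)) (ℕ.≤-trans mj (ℕ.m≤n+m j N))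

-- The (k + 1)-th root, for x ≥ 0.
root : ℝ → ℕ → ℝ
root x k = mkℝ (λ i → approxRoot (suc k) (seq x i) i) (root-cauchy k {seq x} (cauchy x))

-- x to a rational power: for a / b in lowest terms, the a-th power of the b-th
-- root of x.
ratPow : (x : ℝ) → 0ℝ < x → ℚ → ℝ
ratPow x 0<x (mkℚ (+ a)    b-1 _) = root x b-1 ^ a
ratPow x 0<x (mkℚ -[1+ a ] b-1 _) = root (recip x 0<x) b-1 ^ suc a

2≤⇒0< : ∀ {x} → 2ℝ ≤ x → 0ℝ < x
2≤⇒0< {x} 2≤x with 2≤x 1ℚ (ℚ.positive⁻¹ 1ℚ)
... | N , h = 1ℚ , ℚ.positive⁻¹ 1ℚ , N , λ i Ni → ℚ.≤-trans
  (ℚ.+-monoˡ-≤ (ℚ.- 1ℚ) (h i Ni))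
  (ℚ.≤-reflexive (solve 1 (λ a → (a :+ con 1ℚ) :- con 1ℚ := a) refl (seq x i)))
  where open +-*-Solver

2≤⇒0<-1 : ∀ {x} → 2ℝ ≤ x → 0ℝ < x - 1ℝ
2≤⇒0<-1 {x} 2≤x with 2≤x ½ (ℚ.positive⁻¹ ½)
... | N , h = ½ , ℚ.positive⁻¹ ½ , N , λ i Ni → ℚ.≤-trans
  (ℚ.+-monoˡ-≤ (ℚ.- (1ℚ ℚ.+ ½)) (h i Ni))
  (ℚ.≤-reflexive (solve 1 (λ a → (a :+ con ½) :- (con 1ℚ :+ con ½) := a :- con 1ℚ) refl (seq x i)))
  where open +-*-Solver

open import Data.Fin.Subset using (Subset; inside; outside; _∈_; ∣_∣; ∁)
open import Data.Fin.Subset.Properties using (_∈?_)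

subsets : ∀ n → List (Subset n)
subsets zero    = [] ∷ []
subsets (suc n) = map (outside ∷_) (subsets n) List.++ map (inside ∷_) (subsets n)

∑ : ∀ {n} → (Subset n → ℝ) → ℝ
∑ {n} f = foldr _+_ 0ℝ (map f (subsets n))

count : ∀ {n} {P : Subset n → Set} → Decidable P → ℕ
count {n} P? = length (filter P? (subsets n))

Path : ∀ {n} → List (Fin n × Fin n) → Fin n → Fin n → Set
Path []             u v = u ≡ v
Path ((a , b) ∷ xs) u v = Path xs u v ⊎ (Path xs u a × Path xs b v)

path? : ∀ {n} (xs : List (Fin n × Fin n)) u v → Dec (Path xs u v)
path? []             u v = u Fin.≟ v
path? ((a , b) ∷ xs) u v = path? xs u v ⊎-dec (path? xs u a ×-dec path? xs b v)

path-refl : ∀ {n} (xs : List (Fin n × Fin n)) u → Path xs u u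
path-refl []       u = refl
path-refl (_ ∷ xs) u = inj₁ (path-refl xs u)

path-trans : ∀ {n} (xs : List (Fin n × Fin n)) {u v w} → Path xs u v → Path xs v w → Path xs u w
path-trans []       p q = trans p q
path-trans (_ ∷ xs) (inj₁ p)       (inj₁ q)       = inj₁ (path-trans xs p q)
path-trans (_ ∷ xs) (inj₁ p)       (inj₂ (q , r)) = inj₂ (path-trans xs p q , r)
path-trans (_ ∷ xs) (inj₂ (p , q)) (inj₁ r)       = inj₂ (p , path-trans xs q r)
path-trans (_ ∷ xs) (inj₂ (p , _)) (inj₂ (_ , r)) = inj₂ (p , r)

path-step : ∀ {n} (xs : List (Fin n × Fin n)) {u v} → (u , v) List.∈ xs → Path xs u v
path-step (_ ∷ xs) (here refl) = inj₂ (path-refl xs _ , path-refl xs _)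
path-step (_ ∷ xs) (there p)   = inj₁ (path-step xs p)

path-sound : ∀ {n} {R : Fin n → Fin n → Set} (xs : List (Fin n × Fin n)) →
             (∀ {u v} → (u , v) List.∈ xs → R u v) → ∀ {u v} → Path xs u v → Star R u v
path-sound []       f refl           = ε
path-sound (_ ∷ xs) f (inj₁ p)       = path-sound xs (λ i → f (there i)) p
path-sound (_ ∷ xs) f (inj₂ (p , q)) =
  path-sound xs (λ i → f (there i)) p ◅◅ (f (here refl) ◅ path-sound xs (λ i → f (there i)) q)

star? : ∀ {n} {R : Fin n → Fin n → Set} → (∀ u v → Dec (R u v)) → ∀ u v → Dec (Star R u v)
star? {n} {R} R? u v = map′ (path-sound xs sound) complete (path? xs u v)
  where
  R?′ : (e : Fin n × Fin n) → Dec (R (proj₁ e) (proj₂ e))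
  R?′ (a , b) = R? a b
  xs = filter R?′ (cartesianProduct (allFin n) (allFin n))
  sound : ∀ {a b} → (a , b) List.∈ xs → R a b
  sound i = proj₂ (List.∈-filter⁻ R?′ {xs = cartesianProduct (allFin n) (allFin n)} i)
  complete : ∀ {a b} → Star R a b → Path xs a b
  complete ε = path-refl xs _
  complete (r ◅ rs) = path-trans xs
    (path-step xs (List.∈-filter⁺ R?′ (List.∈-cartesianProduct⁺ (List.∈-allFin _) (List.∈-allFin _)) r)) (complete rs)

_⇔-dec_ : ∀ {A B : Set} → Dec A → Dec B → Dec (A ⇔ B)
a? ⇔-dec b? = map′ (λ (f , g) → mk⇔ f g) (λ e → Equivalence.to e , Equivalence.from e)
                ((a? →-dec b?) ×-dec (b? →-dec a?))

∃Vec? : ∀ {n} k {P : Vec (Fin n) k → Set} → Decidable P → Dec (∃ P)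
∃Vec? zero    P? = map′ (λ p → [] , p) (λ { ([] , p) → p }) (P? [])
∃Vec? (suc k) P? = map′ (λ (x , xs , p) → x ∷ xs , p) (λ { (x ∷ xs , p) → x , xs , p })
                     (Fin.any? λ x → ∃Vec? k λ xs → P? (x ∷ xs))

unique? : ∀ {n k} (xs : Vec (Fin n) k) → Dec (Unique xs)
unique? = allPairs? λ x y → ¬? (x Fin.≟ y)

-- Vertices are Fin n and edges Fin size.  Parallel edges and loops are not
-- excluded: simple graphs are the case where distinct edges have distinct
-- unordered pairs of distinct endpoints.
record Graph (n : ℕ) : Set where
  field
    size : ℕ
    ends : Fin size → Fin n × Fin n

module _ {n : ℕ} (G : Graph n) where
  open Graph G

  Joins : Fin size → Fin n → Fin n → Set
  Joins e u v = ends e ≡ (u , v) ⊎ ends e ≡ (v , u)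

  joins? : ∀ e u v → Dec (Joins e u v)
  joins? e u v = ≡-dec Fin._≟_ Fin._≟_ (ends e) (u , v) ⊎-dec ≡-dec Fin._≟_ Fin._≟_ (ends e) (v , u)

  Adjacent : Subset size → Fin n → Fin n → Set
  Adjacent A u v = ∃[ e ] e ∈ A × Joins e u v

  adjacent? : ∀ A u v → Dec (Adjacent A u v)
  adjacent? A u v = Fin.any? λ e → (e ∈? A) ×-dec joins? e u v

  -- C is the vertex set of a connected component of (V , A).
  IsComponent : Subset size → Subset n → Set
  IsComponent A C = ∃[ v ] ∀ u → u ∈ C ⇔ Star (Adjacent A) v u

  isComponent? : ∀ A → Decidable (IsComponent A)
  isComponent? A C = Fin.any? λ v → Fin.all? λ u → (u ∈? C) ⇔-dec star? (adjacent? A) v u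

  k : Subset size → ℕ
  k A = count (isComponent? A)

  edgesIn : Subset n → ℕ
  edgesIn S = length (filter (λ e → (proj₁ (ends e) ∈? S) ×-dec (proj₂ (ends e) ∈? S)) (allFin size))

  Z : ℝ → ℝ → ℝ
  Z q w = ∑ λ A → q ^ k A * w ^ ∣ A ∣

  -- The positivity proof is what makes the quotient w / (q - 1) available.
  Z⁽²⁾ : (q w : ℝ) → 0ℝ < q - 1ℝ → ℝ
  Z⁽²⁾ q w 0<q-1 = ∑ λ S →
    (1ℝ + w) ^ edgesIn S * (q - 1ℝ) ^ (n ℕ.∸ ∣ S ∣) * (1ℝ + w * recip (q - 1ℝ) 0<q-1) ^ edgesIn (∁ S)

  -- vs and es are the vertices and edges met when going once around a cycle:
  -- the i-th edge joins the i-th vertex to the next one, cyclically.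
  IsTour : ∀ {ℓ} .{{_ : ℕ.NonZero ℓ}} → Vec (Fin n) ℓ → Vec (Fin size) ℓ → Set
  IsTour {ℓ} vs es = Unique vs × Unique es ×
    (∀ (i : Fin ℓ) → Joins (lookup es i) (lookup vs i) (lookup vs (suc (toℕ i) mod ℓ)))

  -- C is the edge set of a cycle of length ℓ.  A cycle, regarded as a subgraph,
  -- is determined by its edge set.
  IsCycle : (ℓ : ℕ) .{{_ : ℕ.NonZero ℓ}} → Subset size → Set
  IsCycle ℓ C = ∃[ vs ] ∃[ es ] IsTour {ℓ} vs es × (∀ e → e ∈ C ⇔ e Vec.∈ es)

  isCycle? : (ℓ : ℕ) .{{_ : ℕ.NonZero ℓ}} → Decidable (IsCycle ℓ)
  isCycle? ℓ C = ∃Vec? ℓ λ vs → ∃Vec? ℓ λ es →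
    (unique? vs ×-dec unique? es ×-dec
      Fin.all? λ i → joins? (lookup es i) (lookup vs i) (lookup vs (suc (toℕ i) mod ℓ)))
    ×-dec Fin.all? λ e → (e ∈? C) ⇔-dec anyVec? (e Fin.≟_) es

  -- Lengths at most b, loops having length 1 and pairs of parallel edges length 2.
  cyclesUpTo : ℕ → ℕ
  cyclesUpTo b = count {P = λ C → ∃[ i ] IsCycle (suc (toℕ {b} i)) C} λ C → Fin.any? λ i → isCycle? (suc (toℕ i)) C

  L : ℕ → ℕ
  L g = cyclesUpTo (g ℕ.∸ 1)

{-# OPTIONS --safe #-}
-- Compare the two sums term by term in A ⊆ E.  Expanding the powers of 1 + w and
-- 1 + w / (q - 1) writes Z⁽²⁾ as the sum over A of w ^ |A| times the sum, over the
-- sets S that no edge of A leaves, of (q - 1) ^ (v - e), where v and e count the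
-- vertices and the edges of A outside S.  Such an S is a union of components of
-- (V , A), so the inner sum is the product over the components C of
-- 1 + (q - 1) ^ (v(C) - e(C)).  A factor is at most q, because v(C) - e(C) ≤ 1, and
-- equals q for a tree; it is always at least 1.  Hence
-- product ≤ q ^ k(A) ≤ q ^ c · product, where c is the number of components with a
-- cycle.  Choose a cycle in each of these: at most L of them are shorter than g, and
-- the others are disjoint and have at least g vertices each, so c ≤ n / g + L.
module Submission where

open import Defs using (Graph; Joins; Adjacent; IsTour; IsCycle; isCycle?; IsComponent; isComponent?; subsets; edgesIn; k; L)
open import Algebra.Bundles using (CommutativeSemiring)
open import Algebra.Core using (Op₂)
open import Algebra.Structures using (IsCommutativeSemiring)
open import Data.Bool.Base using (Bool; true; false; not; _∧_; if_then_else_)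
open import Data.Fin.Base using (Fin; zero; suc; toℕ; fromℕ; fromℕ<; inject₁; punchIn; punchOut)
import Data.Fin.Properties as Fin
open import Data.Fin.Relation.Unary.Top using (view; ‵fromℕ; ‵inject₁)
open import Data.Fin.Subset using (Subset; inside; outside; _∈_; ∣_∣; ∁)
open import Data.Fin.Subset.Properties as Subset using (_∈?_)
open import Data.Integer.Base as ℤ using (+_; -[1+_])
import Data.Integer.Properties as ℤ
open import Data.List.Base as List using (List; []; _∷_; allFin; filter; length; foldr)
import Data.List.Properties as List
open import Data.List.Membership.Propositional using () renaming (_∈_ to _∈ˡ_; _∉_ to _∉ˡ_)
open import Data.List.Membership.Propositional.Properties
  using (∈-lookup; ∈-allFin; ∈-filter⁺; ∈-filter⁻; ∈-map⁺; ∈-map⁻; ∈-++⁺ˡ; ∈-++⁺ʳ)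
open import Data.List.Relation.Binary.Disjoint.Propositional using (Disjoint)
open import Data.List.Relation.Unary.All as ListAll using ([]; _∷_) renaming (All to Allˡ)
import Data.List.Relation.Unary.All.Properties as ListAll
open import Data.List.Relation.Unary.AllPairs as ListPairs using (AllPairs; []; _∷_)
import Data.List.Relation.Unary.AllPairs.Properties as ListPairs
open import Data.List.Relation.Unary.Any as ListAny using (here; there)
import Data.List.Relation.Unary.Any.Properties as ListAny
open import Data.List.Relation.Unary.Unique.Propositional using () renaming (Unique to Uniqueˡ)
import Data.List.Relation.Unary.Unique.Propositional.Properties as Uniqueˡ
open import Data.Nat.Base as ℕ using (ℕ; zero; suc; s≤s; z≤n; NonZero)
open import Data.Nat.DivMod using (_mod_; m%n<n; n%n≡0; m<n⇒m%n≡m)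
import Data.Nat.Properties as ℕ
open import Data.Product.Base using (∃; ∃-syntax; _×_; _,_; proj₁; proj₂)
open import Data.Rational.Base as ℚ using (ℚ; mkℚ; 0ℚ; 1ℚ; ½; _/_) renaming (_+_ to _+ℚ_)
import Data.Rational.Properties as ℚ
open import Data.Rational.Solver using (module +-*-Solver)
open import Algebra.Definitions.RawSemiring ℚ.+-*-rawSemiring using () renaming (_^_ to _^ℚᴺ_)
import Data.Rational.Unnormalised.Base as ℚᵘ
import Data.Rational.Unnormalised.Properties as ℚᵘ
open import Data.Sum.Base using (_⊎_; inj₁; inj₂; swap)
open import Data.Vec.Base as Vec using (Vec; []; _∷_; _++_; _∷ʳ_; lookup; tabulate; insertAt)
import Data.Vec.Functional as Vector
import Data.Vec.Functional.Properties as Vector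
open import Data.Vec.Membership.Propositional using () renaming (_∈_ to _∈ᵛ_)
import Data.Vec.Membership.Propositional.Properties as VecMem
import Data.Vec.Properties as Vec
open import Data.Vec.Relation.Unary.All as All using (All; []; _∷_)
import Data.Vec.Relation.Unary.All.Properties as All
open import Data.Vec.Relation.Unary.AllPairs using ([]; _∷_)
import Data.Vec.Relation.Unary.AllPairs.Properties as AllPairs
open import Data.Vec.Relation.Unary.Any as VecAny using (here; there)
import Data.Vec.Relation.Unary.Any.Properties as VecAny
open import Data.Vec.Relation.Unary.Unique.Propositional using (Unique)
open import Function.Base using (id; _∘_)
open import Function.Bundles using (_⇔_; mk⇔; Equivalence)
open import Level using (0ℓ)
open import Relation.Binary.Bundles using (Preorder)
open import Relation.Binary.Construct.Closure.ReflexiveTransitive using (Star; ε; _◅_)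
open import Relation.Binary.Core using (Rel)
open import Relation.Binary.PropositionalEquality
  using (_≡_; _≢_; refl; sym; trans; cong; cong₂; subst; subst₂)
open import Relation.Binary.Structures using (IsEquivalence; IsPreorder)
open import Relation.Nullary using (¬_; Dec; yes; no; does; contradiction; ¬?; _×-dec_)
open import Relation.Nullary.Decidable using (dec-true)

-- A component is never handled as a subgraph. The edges of A are contracted one at a time, keeping
-- a map from the vertices to the current classes and, for each class, the number t = e - v + 1 of
-- its independent cycles: an edge inside a class adds one, an edge between two classes adds their
-- counts. Inductions along this construction show that the final classes are the components of (V ,
-- A), that a class with t > 0 contains a cycle, and that the sum over S is a product over classes.
-- Since v - e = 1 - t, a component contributes 1 + r ρ^t with r = q - 1 and ρ = 1 / r, so that
-- negative exponents do not occur; ρ ≤ 1 because q ≥ 2.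
--
-- The comparison of the sums is carried out in an ordered commutative semiring, where `r` and `ρ`
-- are just elements with product 1. The factor q^(n/g + L) enters as any element Q that bounds q^b
-- for all natural numbers b with b g ≤ n + L g. That the rational power of a real number is such a
-- Q is a separate statement about roots.

private
  variable
    X Y : Set
    m n ℓ : ℕ

-- Counting with lists free of repetition, and the list of all subsets

unique-length≤ : {xs ys : List X} → Uniqueˡ xs → (∀ {x} → x ∈ˡ xs → x ∈ˡ ys) → length xs ℕ.≤ length ys
unique-length≤ {xs = xs} {ys} xs! sub = Fin.injective⇒≤ {f = position} position-injective
  where
  -- The position in `xs` of a value is sent to the position in `ys` of the same value. This is
  -- injective because `xs` has no repetition.
  position : Fin (length xs) → Fin (length ys)
  position i = ListAny.index (sub (∈-lookup i))
  value : ∀ i → List.lookup ys (position i) ≡ List.lookup xs i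
  value i = sym (ListAny.lookup-index (sub (∈-lookup i)))
  injective : {zs : List X} → Uniqueˡ zs → ∀ i j → List.lookup zs i ≡ List.lookup zs j → i ≡ j
  injective (_ ∷ _)   zero    zero    _  = refl
  injective (z ∷ _)   zero    (suc j) eq = contradiction eq (ListAll.lookup z (∈-lookup j))
  injective (z ∷ _)   (suc i) zero    eq = contradiction (sym eq) (ListAll.lookup z (∈-lookup i))
  injective (_ ∷ zs!) (suc i) (suc j) eq = cong suc (injective zs! i j eq)
  position-injective : ∀ {i j} → position i ≡ position j → i ≡ j
  position-injective {i} {j} eq =
    injective xs! i j (trans (sym (value i)) (trans (cong (List.lookup ys) eq) (value j)))

length-filter-¬ : {P : X → Set} (P? : ∀ x → Dec (P x)) (xs : List X) →
  length xs ≡ length (filter (¬? ∘ P?) xs) ℕ.+ length (filter P? xs)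
length-filter-¬ P? [] = refl
length-filter-¬ P? (x ∷ xs) with P? x
... | yes _ = trans (cong suc (length-filter-¬ P? xs)) (sym (ℕ.+-suc _ _))
... | no _  = cong suc (length-filter-¬ P? xs)

subsets-complete : (S : Subset n) → S ∈ˡ subsets n
subsets-complete []                    = here refl
subsets-complete {suc n} (outside ∷ S) = ∈-++⁺ˡ (∈-map⁺ (outside ∷_) (subsets-complete S))
subsets-complete {suc n} (inside ∷ S)  = ∈-++⁺ʳ _ (∈-map⁺ (inside ∷_) (subsets-complete S))

subsets-unique : ∀ n → Uniqueˡ (subsets n)
subsets-unique zero    = [] ∷ []
subsets-unique (suc n) = Uniqueˡ.++⁺ (Uniqueˡ.map⁺ Vec.∷-injectiveʳ (subsets-unique n))
  (Uniqueˡ.map⁺ Vec.∷-injectiveʳ (subsets-unique n)) disjoint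
  where
  disjoint : Disjoint (List.map (outside ∷_) (subsets n)) (List.map (inside ∷_) (subsets n))
  disjoint (p , q) with ∈-map⁻ _ p | ∈-map⁻ _ q
  ... | _ , _ , refl | _ , _ , ()

-- Vectors extended at the end, and cyclic successors of indices

unique-∷ʳ : {x : X} {xs : Vec X ℓ} → Unique xs → All (_≢ x) xs → Unique (xs ∷ʳ x)
unique-∷ʳ []        []         = [] ∷ []
unique-∷ʳ (p ∷ xs!) (q ∷ qs) = all-∷ʳ p q ∷ unique-∷ʳ xs! qs
  where
  all-∷ʳ : ∀ {ℓ x y} {xs : Vec X ℓ} → All (y ≢_) xs → y ≢ x → All (y ≢_) (xs ∷ʳ x)
  all-∷ʳ []       q = q ∷ []
  all-∷ʳ (p ∷ ps) q = p ∷ all-∷ʳ ps q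

lookup-∷ʳ-inject₁ : (xs : Vec X ℓ) (x : X) → ∀ i → lookup (xs ∷ʳ x) (inject₁ i) ≡ lookup xs i
lookup-∷ʳ-inject₁ (_ ∷ _)  x zero    = refl
lookup-∷ʳ-inject₁ (_ ∷ xs) x (suc i) = lookup-∷ʳ-inject₁ xs x i

lookup-∷ʳ-fromℕ : (xs : Vec X ℓ) (x : X) → lookup (xs ∷ʳ x) (fromℕ ℓ) ≡ x
lookup-∷ʳ-fromℕ []       x = refl
lookup-∷ʳ-fromℕ (_ ∷ xs) x = lookup-∷ʳ-fromℕ xs x

next-inject₁ : (i : Fin ℓ) → suc (toℕ (inject₁ i)) mod suc ℓ ≡ suc i
next-inject₁ {ℓ} i = Fin.toℕ-injective (trans (Fin.toℕ-fromℕ< (m%n<n (suc (toℕ (inject₁ i))) (suc ℓ)))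
  (trans (m<n⇒m%n≡m (s≤s (subst (ℕ._< ℓ) (sym (Fin.toℕ-inject₁ i)) (Fin.toℕ<n i)))) (cong suc (Fin.toℕ-inject₁ i))))

next-fromℕ : ∀ ℓ → suc (toℕ (fromℕ ℓ)) mod suc ℓ ≡ zero
next-fromℕ ℓ = Fin.toℕ-injective (trans (Fin.toℕ-fromℕ< (m%n<n (suc (toℕ (fromℕ ℓ))) (suc ℓ)))
  (trans (cong (λ k → suc k ℕ.% suc ℓ) (Fin.toℕ-fromℕ ℓ)) (n%n≡0 (suc ℓ))))

-- Fibres of maps between finite sets, and gluing two points

preimage : (Fin n → Fin m) → Fin m → Subset n
preimage c i = tabulate λ x → does (c x Fin.≟ i)

∈-tabulate⁻ : {P : Fin n → Set} (P? : ∀ x → Dec (P x)) → ∀ x → x ∈ tabulate (λ y → does (P? y)) → P x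
∈-tabulate⁻ P? x x∈ with P? x | trans (sym (Vec.lookup∘tabulate (λ y → does (P? y)) x)) (Vec.[]=⇒lookup x∈)
... | yes p | _ = p

∈-tabulate⁺ : {P : Fin n → Set} (P? : ∀ x → Dec (P x)) → ∀ x → P x → x ∈ tabulate (λ y → does (P? y))
∈-tabulate⁺ P? x p = Vec.lookup⇒[]= x _ (trans (Vec.lookup∘tabulate _ x) (dec-true (P? x) p))

-- The quotient that identifies `i` with `j`, realised by deleting `i` and renumbering the rest;
-- `punchIn i` is then a section of it.
glue : {i j : Fin (suc m)} → i ≢ j → Fin (suc m) → Fin m
glue {i = i} i≢j x with i Fin.≟ x
... | yes _  = punchOut i≢j
... | no i≢x = punchOut i≢x

module _ {i j : Fin (suc m)} (i≢j : i ≢ j) where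

  glue-i : glue i≢j i ≡ punchOut i≢j
  glue-i with i Fin.≟ i
  ... | yes _  = refl
  ... | no i≢i = contradiction refl i≢i

  glue-≢ : ∀ {x} (i≢x : i ≢ x) → glue i≢j x ≡ punchOut i≢x
  glue-≢ {x} i≢x with i Fin.≟ x
  ... | yes i≡x = contradiction i≡x i≢x
  ... | no _    = Fin.punchOut-cong i refl

  glue-identifies : glue i≢j i ≡ glue i≢j j
  glue-identifies = trans glue-i (sym (glue-≢ i≢j))

  glue-punchIn : ∀ x → glue i≢j (punchIn i x) ≡ x
  glue-punchIn x = trans (glue-≢ (Fin.punchInᵢ≢i i x ∘ sym)) (Fin.punchOut-punchIn i)

  glue-fibres : ∀ x y → glue i≢j x ≡ glue i≢j y → x ≡ y ⊎ (x ≡ i × y ≡ j) ⊎ (x ≡ j × y ≡ i)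
  glue-fibres x y eq with i Fin.≟ x | i Fin.≟ y
  ... | yes refl | yes refl = inj₁ refl
  ... | yes refl | no i≢y   = inj₂ (inj₁ (refl , sym (Fin.punchOut-injective i≢j i≢y eq)))
  ... | no i≢x   | yes refl = inj₂ (inj₂ (Fin.punchOut-injective i≢x i≢j eq , refl))
  ... | no i≢x   | no i≢y   = inj₁ (Fin.punchOut-injective i≢x i≢y eq)

-- Walks, contraction of edges, and cycles

module _ {n : ℕ} (G : Graph n) where
  open Graph G

  private
    variable
      e : Fin size
      u v x y z : Fin n
      vs vs′ : Vec (Fin n) ℓ
      es es′ : Vec (Fin size) ℓ

  data Walk : Fin n → Fin n → Vec (Fin n) (suc ℓ) → Vec (Fin size) ℓ → Set where
    stop : Walk x x (x ∷ []) []
    step : Joins G e x z → Walk z y vs es → Walk x y (x ∷ vs) (e ∷ es)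

  walk-++ : Walk x u vs es → Joins G e u v → Walk v y vs′ es′ → Walk x y (vs ++ vs′) (es ++ e ∷ es′)
  walk-++ stop       j w′ = step j w′
  walk-++ (step i w) j w′ = step i (walk-++ w j w′)

  walk-head : Walk x y vs es → x ∈ᵛ vs
  walk-head stop       = here refl
  walk-head (step _ _) = here refl

  joins-ends : Joins G e x y → Joins G e u v → u ≡ x ⊎ u ≡ y
  joins-ends (inj₁ p) (inj₁ q) = inj₁ (cong proj₁ (trans (sym q) p))
  joins-ends (inj₁ p) (inj₂ q) = inj₂ (cong proj₂ (trans (sym q) p))
  joins-ends (inj₂ p) (inj₁ q) = inj₂ (cong proj₁ (trans (sym q) p))
  joins-ends (inj₂ p) (inj₂ q) = inj₁ (cong proj₂ (trans (sym q) p))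

  ends-on-walk : Walk x y vs es → e ∈ᵛ es → Joins G e u v → u ∈ᵛ vs
  ends-on-walk (step i w) (here refl) j with joins-ends i j
  ... | inj₁ refl = here refl
  ... | inj₂ refl = there (walk-head w)
  ends-on-walk (step _ w) (there e∈) j = there (ends-on-walk w e∈ j)

  -- If the first edge occurred again, its endpoint `x` would lie on the rest of the walk, against
  -- the uniqueness of the vertices.
  walk-edges-unique : Walk x y vs es → Unique vs → Unique es
  walk-edges-unique stop             _          = []
  walk-edges-unique (step {es = es} j w) (x∉ ∷ vs!) =
    All.lookup⁻ (λ i eq → All.lookup x∉ (ends-on-walk w (subst (_∈ᵛ es) (sym eq) (VecMem.∈-lookup i es)) j) refl)
    ∷ walk-edges-unique w vs!

  walk-lookup-zero : Walk x y vs es → lookup vs zero ≡ x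
  walk-lookup-zero stop       = refl
  walk-lookup-zero (step _ _) = refl

  walk-lookup-last : Walk {ℓ} x y vs es → lookup vs (fromℕ ℓ) ≡ y
  walk-lookup-last stop       = refl
  walk-lookup-last (step _ w) = walk-lookup-last w

  walk-lookup : Walk {ℓ} x y vs es → ∀ i → Joins G (lookup es i) (lookup vs (inject₁ i)) (lookup vs (suc i))
  walk-lookup (step {e = e} {x = x} j w) zero    = subst (Joins G e x) (sym (walk-lookup-zero w)) j
  walk-lookup (step j w)         (suc i) = walk-lookup w i

  -- The index `suc (toℕ i) mod _` wraps around only at the last position, which holds the new edge
  -- `e` from `y` back to `x`; at the other positions the tour is the walk itself.
  close-walk : Walk x y vs es → Unique vs → All (_≢ e) es → Joins G e y x → IsTour G vs (es ∷ʳ e)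
  close-walk {vs = vs} {es} {e} w vs! e∉es j = vs! , unique-∷ʳ (walk-edges-unique w vs!) e∉es , joins
    where
    joins : ∀ i → Joins G (lookup (es ∷ʳ e) i) (lookup vs i) (lookup vs (suc (toℕ i) mod _))
    joins i with view i
    ... | ‵fromℕ {ℓ} rewrite lookup-∷ʳ-fromℕ es e | next-fromℕ ℓ | walk-lookup-last w | walk-lookup-zero w = j
    ... | ‵inject₁ i′ rewrite lookup-∷ʳ-inject₁ es e i′ | next-inject₁ i′ = walk-lookup w i′

  -- The last two fields are what later steps live on: walks in different classes share no vertex,
  -- so joining them keeps simplicity, and an edge outside `P` is not on the walk, so it can close
  -- the walk to a cycle.
  record Connection (P : List (Fin size)) (c : Fin n → Fin m) (x y : Fin n) : Set where
    field
      {steps} : ℕ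
      {verts} : Vec (Fin n) (suc steps)
      {edges} : Vec (Fin size) steps
      walk     : Walk x y verts edges
      simple   : Unique verts
      inClass  : All (λ z → c z ≡ c x) verts
      inP      : All (_∈ˡ P) edges

  record CycleIn (c : Fin n → Fin m) (i : Fin m) : Set where
    field
      {pred-length} : ℕ
      verts   : Vec (Fin n) (suc pred-length)
      edges   : Vec (Fin size) (suc pred-length)
      tour    : IsTour G verts edges
      inClass : All (λ z → c z ≡ i) verts

  -- Contracting the edges P one after the other leaves the vertex set Fin m; c maps
  -- the vertices of G to it, and t i counts the independent cycles of the class i.
  data Contraction : List (Fin size) → ∀ {m} → (Fin n → Fin m) → (Fin m → ℕ) → Set where
    none  : Contraction [] id (λ _ → 0)
    close : ∀ {P m c} {t : Fin m → ℕ} → Contraction P c t → e ∉ˡ P → Joins G e u v → c u ≡ c v →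
            Contraction (e ∷ P) c (Vector.updateAt t (c u) suc)
    merge : ∀ {P m c} {t : Fin (suc m) → ℕ} → Contraction P c t → e ∉ˡ P → Joins G e u v → (cu≢cv : c u ≢ c v) →
            Contraction (e ∷ P) (glue cu≢cv ∘ c) (Vector.updateAt (t ∘ punchIn (c u)) (punchOut cu≢cv) (t (c u) ℕ.+_))

  private
    variable
      P : List (Fin size)
      c : Fin n → Fin m
      t : Fin m → ℕ

  ends-join : ∀ e → Joins G e (proj₁ (ends e)) (proj₂ (ends e))
  ends-join e = inj₁ refl

  contract : ∀ P → Uniqueˡ P → ∃[ m ] ∃[ c ] ∃[ t ] Contraction P {m} c t
  contract []      []         = _ , _ , _ , none
  contract (e ∷ P) (e∉P ∷ P!) = extend (contract P P!)
    where
    e∉ : e ∉ˡ P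
    e∉ e∈ = ListAll.lookup e∉P e∈ refl
    a = proj₁ (ends e)
    b = proj₂ (ends e)
    extend : ∃[ m ] ∃[ c ] ∃[ t ] Contraction P {m} c t → ∃[ m ] ∃[ c ] ∃[ t ] Contraction (e ∷ P) {m} c t
    -- `merge` asks for a number of classes of the form `suc m`; there is at least one class because
    -- `c` has a value at `a`.
    extend (zero , c , _ , _) with () ← c a
    extend (suc m , c , t , C) with c a Fin.≟ c b
    ... | yes eq = _ , _ , _ , close C e∉ (ends-join e) eq
    ... | no neq = _ , _ , _ , merge C e∉ (ends-join e) neq

  -- Surjectivity of `c`. It makes every class a component, and it makes different classes have
  -- different preimages.
  class-member : Contraction P {m} c t → ∀ i → ∃[ x ] c x ≡ i
  class-member none i = i , refl
  class-member (close C _ _ _) i = class-member C i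
  class-member (merge C _ _ cu≢cv) i with class-member C (punchIn _ i)
  ... | x , cx≡ = x , trans (cong (glue cu≢cv) cx≡) (glue-punchIn cu≢cv i)

  joins-class : ∀ {c : Fin n → Fin m} → Joins G e u v → c u ≡ c v → Joins G e x y → c x ≡ c y
  joins-class (inj₁ p) eq (inj₁ q) with refl ← trans (sym p) q = eq
  joins-class (inj₁ p) eq (inj₂ q) with refl ← trans (sym p) q = sym eq
  joins-class (inj₂ p) eq (inj₁ q) with refl ← trans (sym p) q = sym eq
  joins-class (inj₂ p) eq (inj₂ q) with refl ← trans (sym p) q = eq

  edge-in-class : Contraction P c t → e ∈ˡ P → Joins G e x y → c x ≡ c y
  edge-in-class (close {c = c} C _ j eq) (here refl) i = joins-class {c = c} j eq i
  edge-in-class (close C _ _ _)  (there e∈)  i = edge-in-class C e∈ i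
  edge-in-class (merge {c = c} C _ j neq) (here refl) i =
    joins-class {c = glue neq ∘ c} j (glue-identifies neq) i
  edge-in-class (merge C _ _ neq) (there e∈)  i = cong (glue neq) (edge-in-class C e∈ i)

  coarsen : ∀ {m m′} {c : Fin n → Fin m} (d : Fin m → Fin m′) →
            Connection P c x y → Connection (e ∷ P) (d ∘ c) x y
  coarsen d K = record
    { walk = walk ; simple = simple ; inClass = All.map (cong d) inClass ; inP = All.map there inP }
    where open Connection K

  -- Before the merge the two walks lie in the distinct classes of `u` and `v`, so they are disjoint
  -- and the joined walk is again simple.
  join-connections : ∀ {m m′} {c : Fin n → Fin m} (d : Fin m → Fin m′) → Joins G e u v → c u ≢ c v → d (c u) ≡ d (c v) →
                     Connection P c x u → Connection P c v y → Connection (e ∷ P) (d ∘ c) x y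
  join-connections {c = c} d j cu≢cv eq K K′ = record
    { walk    = walk-++ K.walk j K′.walk
    ; simple  = AllPairs.++⁺ K.simple K′.simple
                  (All.map (λ p → All.map (λ { q refl → cu≢cv (trans cu≡cx (trans (sym p) q)) }) K′.inClass) K.inClass)
    ; inClass = All.++⁺ (All.map (cong d) K.inClass)
                  (All.map (λ p → trans (cong d p) (trans (sym eq) (cong d cu≡cx))) K′.inClass)
    ; inP     = All.++⁺ (All.map there K.inP) (here refl ∷ All.map there K′.inP)
    }
    where
    module K = Connection K
    module K′ = Connection K′
    cu≡cx = All.lookup K.inClass (walk-end K.walk)
      where
      walk-end : ∀ {ℓ x y} {vs : Vec (Fin n) (suc ℓ)} {es} → Walk x y vs es → y ∈ᵛ vs
      walk-end stop       = here refl
      walk-end (step _ w) = there (walk-end w)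

  connected : Contraction P c t → c x ≡ c y → Connection P c x y
  connected none refl = record { walk = stop ; simple = [] ∷ [] ; inClass = refl ∷ [] ; inP = [] }
  connected (close C _ _ _) eq = coarsen id (connected C eq)
  connected {x = x} {y} (merge {c = c} C _ j cu≢cv) eq with glue-fibres cu≢cv (c x) (c y) eq
  ... | inj₁ cx≡cy = coarsen (glue cu≢cv) (connected C cx≡cy)
  ... | inj₂ (inj₁ (cx≡cu , cy≡cv)) = join-connections (glue cu≢cv) j cu≢cv (glue-identifies cu≢cv)
    (connected C cx≡cu) (connected C (sym cy≡cv))
  ... | inj₂ (inj₂ (cx≡cv , cy≡cu)) = join-connections (glue cu≢cv) (swap j) (cu≢cv ∘ sym) (sym (glue-identifies cu≢cv))
    (connected C cx≡cv) (connected C (sym cy≡cu))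

  coarsen-cycle : ∀ {m m′} {c : Fin n → Fin m} {i} (d : Fin m → Fin m′) → CycleIn c i → CycleIn (d ∘ c) (d i)
  coarsen-cycle d Y = record { verts = verts ; edges = edges ; tour = tour ; inClass = All.map (cong d) inClass }
    where open CycleIn Y

  -- A `close` step on the class supplies a cycle directly: the simple walk from `u` to `v` inside
  -- the class, together with `e`, which is not on it since `e ∉ˡ P`. For `u` equal to `v` this
  -- includes loops. A `merge` creates no cycle, but a positive sum of counts has a positive
  -- summand.
  cycle : Contraction P {m} c t → ∀ i → 0 ℕ.< t i → CycleIn c i
  cycle (close {e = e} {u = u} {v} {c = c} {t} C e∉ j eq) i 0<t with i Fin.≟ c u
  ... | yes refl = record
    { verts   = verts
    ; edges   = edges ∷ʳ e
    ; tour    = close-walk walk simple (All.map (λ e′∈ e′≡e → e∉ (subst (_∈ˡ _) e′≡e e′∈)) inP) (swap j)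
    ; inClass = inClass
    }
    where open Connection (connected C eq)
  ... | no i≢cu = cycle C i (subst (0 ℕ.<_) (Vector.updateAt-minimal i (c u) t i≢cu) 0<t)
  cycle (merge {u = u} {v} {c = c} {t} C e∉ j cu≢cv) i 0<t with i Fin.≟ punchOut cu≢cv
  ... | no i≢j′ = subst (CycleIn _) (glue-punchIn cu≢cv i) (coarsen-cycle (glue cu≢cv)
        (cycle C (punchIn (c u) i) (subst (0 ℕ.<_) (Vector.updateAt-minimal i (punchOut cu≢cv) (t ∘ punchIn (c u)) i≢j′) 0<t)))
  ... | yes refl with t (c u) in tcu
  ...   | suc _ = subst (CycleIn _) (glue-i cu≢cv) (coarsen-cycle (glue cu≢cv)
          (cycle C (c u) (subst (0 ℕ.<_) (sym tcu) (s≤s z≤n))))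
  -- With `t (c u)` equal to 0, the positive count is that of the class of `v`.
  ...   | zero  = subst (CycleIn _) (glue-punchIn cu≢cv (punchOut cu≢cv)) (coarsen-cycle (glue cu≢cv)
          (cycle C (punchIn (c u) (punchOut cu≢cv)) (subst (0 ℕ.<_) (Vector.updateAt-updates (punchOut cu≢cv) (t ∘ punchIn (c u))) 0<t)))

  walk-star : {A : Subset size} → Walk x y vs es → All (_∈ A) es → Star (Adjacent G A) x y
  walk-star stop       []         = ε
  walk-star (step j w) (e∈ ∷ es∈) = (_ , e∈ , j) ◅ walk-star w es∈

  elements : Subset size → List (Fin size)
  elements A = filter (_∈? A) (allFin size)

  elements-unique : ∀ A → Uniqueˡ (elements A)
  elements-unique A = Uniqueˡ.filter⁺ (_∈? A) (Uniqueˡ.allFin⁺ size)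

  -- The classes left after contracting A are the components of (V , A)

  module _ {A : Subset size} {c : Fin n → Fin m} {t : Fin m → ℕ} (C : Contraction (elements A) c t) where

    star⇒≡ : Star (Adjacent G A) x y → c x ≡ c y
    star⇒≡ ε = refl
    star⇒≡ ((e , e∈A , j) ◅ s) = trans (edge-in-class C (∈-filter⁺ (_∈? A) (∈-allFin e) e∈A) j) (star⇒≡ s)

    ≡⇒star : c x ≡ c y → Star (Adjacent G A) x y
    ≡⇒star eq = walk-star walk (All.map (λ e∈ → proj₂ (∈-filter⁻ (_∈? A) {xs = allFin size} e∈)) inP)
      where open Connection (connected C eq)

    preimage-isComponent : ∀ i → IsComponent G A (preimage c i)
    preimage-isComponent i with class-member C i
    ... | x , refl = x , λ y → mk⇔
      (λ y∈ → ≡⇒star (sym (∈-tabulate⁻ (λ z → c z Fin.≟ c x) y y∈)))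
      (λ s → ∈-tabulate⁺ (λ z → c z Fin.≟ c x) y (sym (star⇒≡ s)))

    component-isPreimage : ∀ S → IsComponent G A S → ∃[ i ] S ≡ preimage c i
    component-isPreimage S (x , comp) = c x , Subset.⊆-antisym
      (λ {y} y∈ → ∈-tabulate⁺ (λ z → c z Fin.≟ c x) y (sym (star⇒≡ (Equivalence.to (comp y) y∈))))
      (λ {y} y∈ → Equivalence.from (comp y) (≡⇒star (sym (∈-tabulate⁻ (λ z → c z Fin.≟ c x) y y∈))))

    preimage-injective : ∀ {i j} → preimage c i ≡ preimage c j → i ≡ j
    preimage-injective {i} {j} eq with class-member C i
    ... | x , refl = ∈-tabulate⁻ (λ z → c z Fin.≟ j) x (subst (x ∈_) eq (∈-tabulate⁺ (λ z → c z Fin.≟ c x) x refl))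

    -- `preimage c` is a bijection from the classes to the components. Both sides are lengths of
    -- lists without repetition, so mutual inclusion gives the two inequalities.
    k≡classes : k G A ≡ m
    k≡classes = trans (ℕ.≤-antisym
      (unique-length≤ (Uniqueˡ.filter⁺ (isComponent? G A) (subsets-unique n)) λ {S} S∈ →
        let i , eq = component-isPreimage S (proj₂ (∈-filter⁻ (isComponent? G A) {xs = subsets n} S∈))
        in subst (_∈ˡ List.map (preimage c) (allFin m)) (sym eq) (∈-map⁺ (preimage c) (∈-allFin i)))
      (unique-length≤ (Uniqueˡ.map⁺ preimage-injective (Uniqueˡ.allFin⁺ m)) λ {S} S∈ →
        let i , _ , eq = ∈-map⁻ (preimage c) {xs = allFin m} S∈
        in ∈-filter⁺ (isComponent? G A) (subsets-complete S) (subst (IsComponent G A) (sym eq) (preimage-isComponent i))))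
      (trans (List.length-map (preimage c) (allFin m)) (List.length-tabulate id))

  -- Counting one cycle per class, short and long

  LocatedCycle : (Fin n → Fin m) → Set
  LocatedCycle c = ∃ (CycleIn c)

  edgeSet : {c : Fin n → Fin m} → LocatedCycle c → Subset size
  edgeSet (_ , Y) = tabulate λ e → does (VecAny.any? (e Fin.≟_) (CycleIn.edges Y))

  vertices : {c : Fin n → Fin m} → LocatedCycle c → List (Fin n)
  vertices (_ , Y) = Vec.toList (CycleIn.verts Y)

  module _ {c : Fin n → Fin m} where

    ∈-edgeSet : (Y : LocatedCycle c) → ∀ e → e ∈ edgeSet Y ⇔ e ∈ᵛ CycleIn.edges (proj₂ Y)
    ∈-edgeSet (_ , Y) e = mk⇔ (∈-tabulate⁻ (λ e → VecAny.any? (e Fin.≟_) (CycleIn.edges Y)) e)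
      (∈-tabulate⁺ (λ e → VecAny.any? (e Fin.≟_) (CycleIn.edges Y)) e)

    cycle-edge-class : (Y : LocatedCycle c) → ∀ a → c (proj₁ (ends (lookup (CycleIn.edges (proj₂ Y)) a))) ≡ proj₁ Y
    cycle-edge-class (_ , Y) a with joins-ends (proj₂ (proj₂ (CycleIn.tour Y)) a) (ends-join _)
    ... | inj₁ eq = trans (cong c eq) (All.lookup⁺ (CycleIn.inClass Y) a)
    ... | inj₂ eq = trans (cong c eq) (All.lookup⁺ (CycleIn.inClass Y) _)

    -- A cycle has at least one edge, and the endpoints of its edges lie in its class, so the edge
    -- set determines the class. As `L` counts edge sets, cycles chosen in different classes are
    -- thereby counted separately.
    edgeSet-injective : (Y Y′ : LocatedCycle c) → edgeSet Y ≡ edgeSet Y′ → proj₁ Y ≡ proj₁ Y′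
    edgeSet-injective Y@(_ , Z) Y′@(_ , Z′) eq = trans (sym (cycle-edge-class Y zero))
      (trans (cong (λ e → c (proj₁ (ends e))) (VecAny.lookup-index e∈′)) (cycle-edge-class Y′ (VecAny.index e∈′)))
      where
      e₀ = lookup (CycleIn.edges Z) zero
      e∈′ : e₀ ∈ᵛ CycleIn.edges Z′
      e∈′ = Equivalence.to (∈-edgeSet Y′ e₀)
              (subst (e₀ ∈_) eq (Equivalence.from (∈-edgeSet Y e₀) (VecMem.∈-lookup zero (CycleIn.edges Z))))

    vertices-class : (Y : LocatedCycle c) → x ∈ˡ vertices Y → c x ≡ proj₁ Y
    vertices-class (_ , Y) x∈ = All.lookup (CycleIn.inClass Y) (VecMem.∈-toList⁻ x∈)

    vertices-unique : (Y : LocatedCycle c) → Uniqueˡ (vertices Y)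
    vertices-unique (_ , Y) = toList-unique (proj₁ (CycleIn.tour Y))
      where
      toList-unique : ∀ {ℓ} {vs : Vec (Fin n) ℓ} → Unique vs → Uniqueˡ (Vec.toList vs)
      toList-unique []         = []
      toList-unique (x∉ ∷ vs!) = All.toList⁺ x∉ ∷ toList-unique vs!

    DistinctClasses : List (LocatedCycle c) → Set
    DistinctClasses = AllPairs (λ Y Y′ → proj₁ Y ≢ proj₁ Y′)

    Short : ℕ → LocatedCycle c → Set
    Short g (_ , Y) = suc (CycleIn.pred-length Y) ℕ.< g

    short? : ∀ g (Y : LocatedCycle c) → Dec (Short g Y)
    short? g (_ , Y) = suc (CycleIn.pred-length Y) ℕ.<? g

    short-cycles≤L : ∀ g {Ys} → DistinctClasses Ys → length (filter (short? g) Ys) ℕ.≤ L G g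
    short-cycles≤L g {Ys} dis = ℕ.≤-trans (ℕ.≤-reflexive (sym (List.length-map edgeSet short)))
      (unique-length≤ {xs = List.map edgeSet short}
        (ListPairs.map⁺ (ListPairs.map (λ {Y} {Y′} ne eq → ne (edgeSet-injective Y Y′ eq))
          (ListPairs.filter⁺ (short? g) dis)))
        counted)
      where
      short = filter (short? g) Ys
      cyclesOfLength? = λ C → Fin.any? λ i → isCycle? G (suc (toℕ {g ℕ.∸ 1} i)) C
      isCycle : (Y : LocatedCycle c) → Short g Y → ∃[ i ] IsCycle G (suc (toℕ {g ℕ.∸ 1} i)) (edgeSet Y)
      isCycle Y@(_ , Z) Y<g = fromℕ< Y<g-1 , subst (λ ℓ → IsCycle G (suc ℓ) (edgeSet Y)) (sym (Fin.toℕ-fromℕ< Y<g-1))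
        (CycleIn.verts Z , CycleIn.edges Z , CycleIn.tour Z , ∈-edgeSet Y)
        -- Lengths are indexed by their predecessors: a length below `g` is `suc i` for some `i`
        -- below `g ∸ 1`.
        where Y<g-1 = ℕ.∸-monoˡ-≤ 1 Y<g
      counted : ∀ {S} → S ∈ˡ List.map edgeSet short → S ∈ˡ filter cyclesOfLength? (subsets size)
      counted {S} S∈ with ∈-map⁻ edgeSet {xs = short} S∈
      ... | Y , Y∈ , refl = ∈-filter⁺ cyclesOfLength? (subsets-complete S)
        (isCycle Y (proj₂ (∈-filter⁻ (short? g) {xs = Ys} Y∈)))

    -- A vertex lies in only one class, so the concatenated vertex lists of the long cycles have no
    -- repetition and fit into the `n` vertices.
    long-cycles*g≤n : ∀ g {Ys} → DistinctClasses Ys → length (filter (¬? ∘ short? g) Ys) ℕ.* g ℕ.≤ n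
    long-cycles*g≤n g {Ys} dis = ℕ.≤-trans (total long (ListAll.all-filter (¬? ∘ short? g) Ys))
      (ℕ.≤-trans (unique-length≤ {ys = allFin n}
        (Uniqueˡ.concat⁺ (ListAll.map⁺ (ListAll.tabulate λ {Y} _ → vertices-unique Y))
          (ListPairs.map⁺ (ListPairs.map
            (λ {Y} {Y′} ne {_} (x∈ , x∈′) → ne (trans (sym (vertices-class Y x∈)) (vertices-class Y′ x∈′)))
            (ListPairs.filter⁺ (¬? ∘ short? g) dis))))
        (λ _ → ∈-allFin _))
        (ℕ.≤-reflexive (List.length-tabulate id)))
      where
      long = filter (¬? ∘ short? g) Ys
      total : ∀ Zs → Allˡ (λ Z → ¬ Short g Z) Zs → length Zs ℕ.* g ℕ.≤ length (List.concat (List.map vertices Zs))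
      total []       []         = z≤n
      total (Z@(_ , Y) ∷ Zs) (g≤Z ∷ g≤Zs) = ℕ.≤-trans
        (ℕ.+-mono-≤ (ℕ.≤-trans (ℕ.≮⇒≥ g≤Z) (ℕ.≤-reflexive (sym (Vec.length-toList (CycleIn.verts Y))))) (total Zs g≤Zs))
        (ℕ.≤-reflexive (sym (List.length-++ (vertices Z))))

    -- The bound n / g + L on the number of cycles, multiplied by `g` to remain in the natural
    -- numbers.
    cycles*g≤ : ∀ g {Ys} → DistinctClasses Ys → length Ys ℕ.* g ℕ.≤ n ℕ.+ L G g ℕ.* g
    cycles*g≤ g {Ys} dis rewrite length-filter-¬ (short? g) Ys
      | ℕ.*-distribʳ-+ g (length (filter (¬? ∘ short? g) Ys)) (length (filter (short? g) Ys)) =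
      ℕ.+-mono-≤ (long-cycles*g≤n g dis) (ℕ.*-monoˡ-≤ g (short-cycles≤L g dis))

  cyclic-classes : (Fin m → ℕ) → List (Fin m)
  cyclic-classes t = filter (λ i → 0 ℕ.<? t i) (allFin _)

  cyclic-classes*g≤ : Contraction P {m} c t → ∀ g → length (cyclic-classes t) ℕ.* g ℕ.≤ n ℕ.+ L G g ℕ.* g
  cyclic-classes*g≤ {m = m} {c} {t} C g = subst (λ b → b ℕ.* g ℕ.≤ n ℕ.+ L G g ℕ.* g)
    (trans (sym (List.length-map proj₁ located)) (cong length (proj₁-toList cycles)))
    (cycles*g≤ g (ListPairs.map⁻ (subst Uniqueˡ (sym (proj₁-toList cycles)) (Uniqueˡ.filter⁺ (λ i → 0 ℕ.<? t i) (Uniqueˡ.allFin⁺ m)))))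
    where
    cycles : Allˡ (CycleIn c) (cyclic-classes t)
    cycles = ListAll.map (λ {i} → cycle C i) (ListAll.all-filter (λ i → 0 ℕ.<? t i) (allFin m))
    located = ListAll.toList cycles
    proj₁-toList : ∀ {is} (ps : Allˡ (CycleIn c) is) → List.map proj₁ (ListAll.toList ps) ≡ is
    proj₁-toList []       = refl
    proj₁-toList (p ∷ ps) = cong (_ ∷_) (proj₁-toList ps)

-- Subsets of classes and the vertex sets they cover

does-∈? : ∀ {n} (x : Fin n) (S : Subset n) → does (x ∈? S) ≡ lookup S x
does-∈? zero    (inside ∷ S)  = refl
does-∈? zero    (outside ∷ S) = refl
does-∈? (suc x) (_ ∷ S)       = does-∈? x S

lookup-insertAt : ∀ {m} {i j : Fin (suc m)} (i≢j : i ≢ j) (T : Subset m) (x : Fin (suc m)) →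
                  lookup (insertAt T i (lookup T (punchOut i≢j))) x ≡ lookup T (glue i≢j x)
lookup-insertAt {i = i} i≢j T x with i Fin.≟ x
... | yes refl = Vec.insertAt-lookup T i _
... | no i≢x = trans (cong (lookup (insertAt T i _)) (sym (Fin.punchIn-punchOut i≢x)))
                 (Vec.insertAt-punchIn T i _ (punchOut i≢x))

-- The union of the classes in T. For a contraction, these are the vertex sets that no contracted
-- edge leaves.
pullback : ∀ {m n} → (Fin n → Fin m) → Subset m → Subset n
pullback c T = tabulate (lookup T ∘ c)

-- A subset that puts `i` on the same side as `j` is constant on the glued pair, hence comes from
-- the quotient.
pullback-insertAt : ∀ {m n} (c : Fin n → Fin (suc m)) {i j : Fin (suc m)} (i≢j : i ≢ j) (T : Subset m) →
                    pullback c (insertAt T i (lookup T (punchOut i≢j))) ≡ pullback (glue i≢j ∘ c) T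
pullback-insertAt c i≢j T = Vec.tabulate-cong (lookup-insertAt i≢j T ∘ c)

-- Powers, products and sums over subsets in an ordered commutative semiring

record OrderedCommutativeSemiring : Set₁ where
  infix 4 _≤_
  field
    commutativeSemiring : CommutativeSemiring 0ℓ 0ℓ
  open CommutativeSemiring commutativeSemiring public hiding (refl; sym; trans; reflexive; zero)
  field
    _≤_        : Rel Carrier 0ℓ
    isPreorder : IsPreorder _≈_ _≤_
    +-mono     : ∀ {x y z u} → x ≤ y → z ≤ u → x + z ≤ y + u
    *-monoˡ    : ∀ {x y z} → 0# ≤ z → x ≤ y → z * x ≤ z * y
    0≤1        : 0# ≤ 1#
  preorder : Preorder 0ℓ 0ℓ 0ℓ
  preorder = record { isPreorder = isPreorder }

module OrderedSemiring (R : OrderedCommutativeSemiring) where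
  open OrderedCommutativeSemiring R
  open CommutativeSemiring commutativeSemiring using ()
    renaming (refl to ≈-refl; sym to ≈-sym; trans to ≈-trans; reflexive to ≈-reflexive)
  open import Algebra.Properties.Semiring.Exp semiring
    using (_^_; ^-homo-*)
  open import Algebra.Properties.CommutativeMonoid.Sum *-commutativeMonoid
    using () renaming (sum to ∏; sum-cong-≋ to ∏-cong; sum-remove to ∏-remove; ∑-distrib-+ to ∏-distrib; sum-replicate to ∏-replicate)
  open import Algebra.Solver.CommutativeMonoid *-commutativeMonoid using (solve; _⊕_; _⊜_)
  import Algebra.Solver.CommutativeMonoid +-commutativeMonoid as +-Solver
  open import Relation.Binary.Reasoning.Preorder preorder
  open IsPreorder isPreorder using () renaming (refl to ≤-refl; trans to ≤-trans; reflexive to ≤-reflexive)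

  *-mono : ∀ {x y z u} → 0# ≤ z → 0# ≤ y → x ≤ y → z ≤ u → x * z ≤ y * u
  *-mono {x} {y} {z} {u} 0≤z 0≤y x≤y z≤u = begin
    x * z  ≈⟨ *-comm x z ⟩
    z * x  ∼⟨ *-monoˡ 0≤z x≤y ⟩
    z * y  ≈⟨ *-comm z y ⟩
    y * z  ∼⟨ *-monoˡ 0≤y z≤u ⟩
    y * u  ∎

  *-nonneg : ∀ {x y} → 0# ≤ x → 0# ≤ y → 0# ≤ x * y
  *-nonneg {x} 0≤x 0≤y = ≤-trans (≤-reflexive (≈-sym (zeroʳ x))) (*-monoˡ 0≤x 0≤y)

  +-nonneg : ∀ {x y} → 0# ≤ x → 0# ≤ y → 0# ≤ x + y
  +-nonneg 0≤x 0≤y = ≤-trans (≤-reflexive (≈-sym (+-identityˡ 0#))) (+-mono 0≤x 0≤y)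

  ^-nonneg : ∀ {x} m → 0# ≤ x → 0# ≤ x ^ m
  ^-nonneg zero    0≤x = 0≤1
  ^-nonneg (suc m) 0≤x = *-nonneg 0≤x (^-nonneg m 0≤x)

  ^-≤1 : ∀ {x} m → 0# ≤ x → x ≤ 1# → x ^ m ≤ 1#
  ^-≤1 zero    0≤x x≤1 = ≤-refl
  ^-≤1 (suc m) 0≤x x≤1 = ≤-trans (*-mono (^-nonneg m 0≤x) 0≤1 x≤1 (^-≤1 m 0≤x x≤1)) (≤-reflexive (*-identityˡ 1#))

  ^-mono : ∀ {x y} m → 0# ≤ x → x ≤ y → x ^ m ≤ y ^ m
  ^-mono zero    0≤x x≤y = ≤-refl
  ^-mono (suc m) 0≤x x≤y = *-mono (^-nonneg m 0≤x) (≤-trans 0≤x x≤y) x≤y (^-mono m 0≤x x≤y)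

  1≤^ : ∀ {x} m → 1# ≤ x → 1# ≤ x ^ m
  1≤^ zero    1≤x = ≤-refl
  1≤^ (suc m) 1≤x = ≤-trans (≤-reflexive (≈-sym (*-identityˡ 1#))) (*-mono 0≤1 (≤-trans 0≤1 1≤x) 1≤x (1≤^ m 1≤x))

  ^-monoʳ : ∀ {x m o} → 1# ≤ x → m ℕ.≤ o → x ^ m ≤ x ^ o
  ^-monoʳ {o = o} 1≤x ℕ.z≤n = 1≤^ o 1≤x
  ^-monoʳ 1≤x (ℕ.s≤s m≤o)   = *-monoˡ (≤-trans 0≤1 1≤x) (^-monoʳ 1≤x m≤o)

  ∏-nonneg : ∀ {m} {f : Fin m → Carrier} → (∀ i → 0# ≤ f i) → 0# ≤ ∏ f
  ∏-nonneg {zero}  0≤f = 0≤1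
  ∏-nonneg {suc m} 0≤f = *-nonneg (0≤f zero) (∏-nonneg (0≤f ∘ suc))

  ∏-mono : ∀ {m} {f g : Fin m → Carrier} → (∀ i → 0# ≤ f i) → (∀ i → f i ≤ g i) → ∏ f ≤ ∏ g
  ∏-mono {zero}  0≤f f≤g = ≤-refl
  ∏-mono {suc m} 0≤f f≤g = *-mono (∏-nonneg (0≤f ∘ suc)) (≤-trans (0≤f zero) (f≤g zero)) (f≤g zero)
    (∏-mono (0≤f ∘ suc) (f≤g ∘ suc))

  ∏-update : ∀ {m} {f g : Fin m → Carrier} {x} (j : Fin m) →
             f j ≈ x * g j → (∀ i → i ≢ j → f i ≈ g i) → ∏ f ≈ x * ∏ g
  ∏-update zero fj fi = ≈-trans (*-cong fj (∏-cong λ i → fi (suc i) λ ())) (*-assoc _ _ _)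
  ∏-update {f = f} {g} {x} (suc j) fj fi = ≈-trans
    (*-cong (fi zero λ ()) (∏-update j fj (λ i i≢j → fi (suc i) (i≢j ∘ Fin.suc-injective))))
    (solve 3 (λ a b c → a ⊕ (b ⊕ c) ⊜ b ⊕ (a ⊕ c)) ≈-refl (g zero) x (∏ (g ∘ suc)))

  ∏ˡ : {X : Set} → (X → Carrier) → List X → Carrier
  ∏ˡ f = foldr (λ x → f x *_) 1#

  ∏ˡ-tabulate : ∀ {X : Set} {m} (f : X → Carrier) (g : Fin m → X) → ∏ˡ f (List.tabulate g) ≡ ∏ (f ∘ g)
  ∏ˡ-tabulate {m = zero}  f g = refl
  ∏ˡ-tabulate {m = suc m} f g = cong (f (g zero) *_) (∏ˡ-tabulate f (g ∘ suc))

  ∏ˡ-filter : ∀ {X : Set} {P : X → Set} (P? : ∀ x → Dec (P x)) f xs →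
              ∏ˡ f (filter P? xs) ≈ ∏ˡ (λ x → if does (P? x) then f x else 1#) xs
  ∏ˡ-filter P? f []       = ≈-refl
  ∏ˡ-filter P? f (x ∷ xs) with does (P? x)
  ... | true  = *-congˡ (∏ˡ-filter P? f xs)
  ... | false = ≈-trans (∏ˡ-filter P? f xs) (≈-sym (*-identityˡ _))

  ∏ˡ-const : ∀ {X : Set} x (xs : List X) → ∏ˡ (λ _ → x) xs ≡ x ^ length xs
  ∏ˡ-const x []       = refl
  ∏ˡ-const x (_ ∷ xs) = cong (x *_) (∏ˡ-const x xs)

  ∏-filter : ∀ {m} {P : Fin m → Set} (P? : ∀ i → Dec (P i)) f →
             ∏ˡ f (filter P? (allFin m)) ≈ ∏ (λ i → if does (P? i) then f i else 1#)
  ∏-filter {m} P? f = ≈-trans (∏ˡ-filter P? f (allFin m)) (≈-reflexive (∏ˡ-tabulate {m = m} (λ i → if does (P? i) then f i else 1#) id))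

  ∏-count : ∀ {m} {P : Fin m → Set} (P? : ∀ i → Dec (P i)) x →
            x ^ length (filter P? (allFin m)) ≈ ∏ (λ i → if does (P? i) then x else 1#)
  ∏-count {m} P? x = ≈-trans (≈-reflexive (sym (∏ˡ-const x (filter P? (allFin m))))) (∏-filter P? (λ _ → x))

  ∏-card : ∀ {m} x (S : Subset m) → x ^ ∣ S ∣ ≈ ∏ (λ i → if lookup S i then x else 1#)
  ∏-card x []            = ≈-refl
  ∏-card x (inside ∷ S)  = *-congˡ (∏-card x S)
  ∏-card x (outside ∷ S) = ≈-trans (∏-card x S) (≈-sym (*-identityˡ _))

  ∑ˡ : {X : Set} → (X → Carrier) → List X → Carrier
  ∑ˡ f xs = foldr _+_ 0# (List.map f xs)

  ∑ : ∀ {m} → (Subset m → Carrier) → Carrier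
  ∑ {m} f = ∑ˡ f (subsets m)

  private
    variable
      f g : X → Carrier

  ∑ˡ-cong : (∀ x → f x ≈ g x) → ∀ xs → ∑ˡ f xs ≈ ∑ˡ g xs
  ∑ˡ-cong eq []       = ≈-refl
  ∑ˡ-cong eq (x ∷ xs) = +-cong (eq x) (∑ˡ-cong eq xs)

  ∑ˡ-mono : (∀ x → f x ≤ g x) → ∀ xs → ∑ˡ f xs ≤ ∑ˡ g xs
  ∑ˡ-mono le []       = ≤-refl
  ∑ˡ-mono le (x ∷ xs) = +-mono (le x) (∑ˡ-mono le xs)

  ∑ˡ-*ˡ : ∀ a (f : X → Carrier) xs → a * ∑ˡ f xs ≈ ∑ˡ (λ x → a * f x) xs
  ∑ˡ-*ˡ a f []       = zeroʳ a
  ∑ˡ-*ˡ a f (x ∷ xs) = ≈-trans (distribˡ a (f x) _) (+-congˡ (∑ˡ-*ˡ a f xs))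

  +-interchange : ∀ a b c d → (a + b) + (c + d) ≈ (a + c) + (b + d)
  +-interchange = +-Solver.solve 4 (λ a b c d → (a +-Solver.⊕ b) +-Solver.⊕ (c +-Solver.⊕ d) +-Solver.⊜
                                                (a +-Solver.⊕ c) +-Solver.⊕ (b +-Solver.⊕ d)) ≈-refl

  ∑ˡ-+ : ∀ (f g : X → Carrier) xs → ∑ˡ (λ x → f x + g x) xs ≈ ∑ˡ f xs + ∑ˡ g xs
  ∑ˡ-+ f g []       = ≈-sym (+-identityˡ 0#)
  ∑ˡ-+ f g (x ∷ xs) = ≈-trans (+-congˡ (∑ˡ-+ f g xs)) (+-interchange _ _ _ _)

  ∑ˡ-zero : ∀ (xs : List X) → ∑ˡ (λ _ → 0#) xs ≈ 0#
  ∑ˡ-zero []       = ≈-refl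
  ∑ˡ-zero (_ ∷ xs) = ≈-trans (+-identityˡ _) (∑ˡ-zero xs)

  ∑ˡ-swap : ∀ (f : X → Y → Carrier) xs ys → ∑ˡ (λ x → ∑ˡ (f x) ys) xs ≈ ∑ˡ (λ y → ∑ˡ (λ x → f x y) xs) ys
  ∑ˡ-swap f []       ys = ≈-sym (∑ˡ-zero ys)
  ∑ˡ-swap f (x ∷ xs) ys = ≈-trans (+-congˡ (∑ˡ-swap f xs ys)) (≈-sym (∑ˡ-+ (f x) (λ y → ∑ˡ (λ x → f x y) xs) ys))

  ∑ˡ-++ : ∀ (f : X → Carrier) xs ys → ∑ˡ f (xs List.++ ys) ≈ ∑ˡ f xs + ∑ˡ f ys
  ∑ˡ-++ f []       ys = ≈-sym (+-identityˡ _)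
  ∑ˡ-++ f (x ∷ xs) ys = ≈-trans (+-congˡ (∑ˡ-++ f xs ys)) (≈-sym (+-assoc _ _ _))

  ∑-suc : ∀ {m} (f : Subset (suc m) → Carrier) → ∑ f ≈ ∑ (λ T → f (outside ∷ T)) + ∑ (λ T → f (inside ∷ T))
  ∑-suc {m} f = ≈-trans (∑ˡ-++ f (List.map (outside ∷_) (subsets m)) _)
    (≈-reflexive (cong₂ (λ as bs → foldr _+_ 0# as + foldr _+_ 0# bs)
      (sym (List.map-∘ (subsets m))) (sym (List.map-∘ (subsets m)))))

  ∑-insertAt : ∀ {m} (f : Subset (suc m) → Carrier) i →
               ∑ f ≈ ∑ (λ T → f (insertAt T i outside) + f (insertAt T i inside))
  ∑-insertAt {m} f zero = ≈-trans (∑-suc f) (≈-sym (∑ˡ-+ (λ T → f (outside ∷ T)) (λ T → f (inside ∷ T)) (subsets m)))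
  ∑-insertAt {suc m} f (suc i) = ≈-trans (∑-suc f) (≈-trans
    (+-cong (∑-insertAt (λ T → f (outside ∷ T)) i) (∑-insertAt (λ T → f (inside ∷ T)) i))
    (≈-sym (∑-suc (λ T → f (insertAt T (suc i) outside) + f (insertAt T (suc i) inside)))))

  -- Distributivity: choosing a summand in every factor is choosing a subset. Applied to classes it
  -- factors the sum over unions of components; applied to edges it expands the powers into a sum
  -- over edge sets.
  ∑-∏ : ∀ {m} (f : Fin m → Bool → Carrier) →
        ∑ (λ T → ∏ (λ i → f i (lookup T i))) ≈ ∏ (λ i → f i outside + f i inside)
  ∑-∏ {zero}  f = +-identityʳ 1#
  ∑-∏ {suc m} f = begin-equality
    ∑ (λ T → ∏ (λ i → f i (lookup T i)))          ≈⟨ ∑-suc (λ T → ∏ (λ i → f i (lookup T i))) ⟩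
    ∑ (λ T → f zero outside * rest T) + ∑ (λ T → f zero inside * rest T)
      ≈⟨ +-cong (∑ˡ-*ˡ (f zero outside) rest (subsets m)) (∑ˡ-*ˡ (f zero inside) rest (subsets m)) ⟨
    f zero outside * ∑ rest + f zero inside * ∑ rest  ≈⟨ distribʳ (∑ rest) (f zero outside) (f zero inside) ⟨
    (f zero outside + f zero inside) * ∑ rest         ≈⟨ *-congˡ (∑-∏ (f ∘ suc)) ⟩
    ∏ (λ i → f i outside + f i inside)                ∎
    where
    rest : Subset m → Carrier
    rest T = ∏ (λ i → f (suc i) (lookup T i))

  -- The rank 2 approximation as a sum over edge sets

  module _ {n} (G : Graph n) (r ρ : Carrier) (rρ≈1 : r * ρ ≈ 1#) where
    open Graph G

    -- With r = q - 1 and ρ = 1 / r: an edge outside S contributes 1 / r, an edge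
    -- leaving S excludes S, and a component outside S contributes r ^ (v - e).
    compat : Bool → Bool → Carrier
    compat inside  inside  = 1#
    compat outside outside = ρ
    compat _       _       = 0#

    edgeWeight : Subset n → Fin size → Carrier
    edgeWeight S e = compat (lookup S (proj₁ (ends e))) (lookup S (proj₂ (ends e)))

    -- Here `s` is the number e - v + 1 of independent cycles, so `r * ρ ^ s` is r^(v - e) without a
    -- negative exponent.
    classWeight : ℕ → Bool → Carrier
    classWeight s inside  = 1#
    classWeight s outside = r * ρ ^ s

    weight : ∀ {m} → (Fin m → ℕ) → Subset m → Carrier
    weight t T = ∏ (λ i → classWeight (t i) (lookup T i))

    classWeight-suc : ∀ s b → classWeight (suc s) b ≈ compat b b * classWeight s b
    classWeight-suc s inside  = ≈-sym (*-identityˡ 1#)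
    classWeight-suc s outside = solve 3 (λ a b c → a ⊕ (b ⊕ c) ⊜ b ⊕ (a ⊕ c)) ≈-refl r ρ (ρ ^ s)

    -- Two outside classes bring two factors `r`, but the merged class has only one. The merging
    -- edge contributes `ρ`, which cancels the other.
    classWeight-+ : ∀ s s′ b → classWeight (s ℕ.+ s′) b ≈ (compat b b * classWeight s b) * classWeight s′ b
    classWeight-+ s s′ inside  = ≈-sym (≈-trans (*-identityʳ _) (*-identityˡ 1#))
    classWeight-+ s s′ outside = begin-equality
      r * ρ ^ (s ℕ.+ s′)                ≈⟨ *-congˡ (^-homo-* ρ s s′) ⟩
      r * (ρ ^ s * ρ ^ s′)              ≈⟨ *-identityˡ _ ⟨
      1# * (r * (ρ ^ s * ρ ^ s′))       ≈⟨ *-congʳ rρ≈1 ⟨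
      (r * ρ) * (r * (ρ ^ s * ρ ^ s′))
        ≈⟨ solve 4 (λ a b c d → (a ⊕ b) ⊕ (a ⊕ (c ⊕ d)) ⊜ (b ⊕ (a ⊕ c)) ⊕ (a ⊕ d)) ≈-refl r ρ (ρ ^ s) (ρ ^ s′) ⟩
      (ρ * (r * ρ ^ s)) * (r * ρ ^ s′)  ∎

    compat-sym : ∀ a b → compat a b ≡ compat b a
    compat-sym inside  inside  = refl
    compat-sym inside  outside = refl
    compat-sym outside inside  = refl
    compat-sym outside outside = refl

    edgeWeight-joins : ∀ {e u v} → Joins G e u v → ∀ S → edgeWeight S e ≡ compat (lookup S u) (lookup S v)
    edgeWeight-joins (inj₁ eq) S = cong (λ p → compat (lookup S (proj₁ p)) (lookup S (proj₂ p))) eq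
    edgeWeight-joins {u = u} {v} (inj₂ eq) S = trans (cong (λ p → compat (lookup S (proj₁ p)) (lookup S (proj₂ p))) eq)
      (compat-sym (lookup S v) (lookup S u))

    edgeWeight-pullback : ∀ {m e u v} → Joins G e u v → (c : Fin n → Fin m) → ∀ T →
                          edgeWeight (pullback c T) e ≡ compat (lookup T (c u)) (lookup T (c v))
    edgeWeight-pullback {u = u} {v} j c T = trans (edgeWeight-joins j (pullback c T))
      (cong₂ compat (Vec.lookup∘tabulate (lookup T ∘ c) u) (Vec.lookup∘tabulate (lookup T ∘ c) v))

    weight-close : ∀ {m} (t : Fin m → ℕ) j T →
                   compat (lookup T j) (lookup T j) * weight t T ≈ weight (Vector.updateAt t j suc) T
    weight-close t j T = ≈-sym (∏-update j
      (≈-trans (≈-reflexive (cong (λ s → classWeight s (lookup T j)) (Vector.updateAt-updates j t))) (classWeight-suc (t j) (lookup T j)))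
      (λ i i≢j → ≈-reflexive (cong (λ s → classWeight s (lookup T i)) (Vector.updateAt-minimal i j t i≢j))))

    weight-insertAt : ∀ {m} (t : Fin (suc m) → ℕ) i T b →
                      weight t (insertAt T i b) ≈ classWeight (t i) b * weight (t ∘ punchIn i) T
    weight-insertAt t i T b = ≈-trans (∏-remove {i = i} (λ x → classWeight (t x) (lookup (insertAt T i b) x)))
      (*-cong (≈-reflexive (cong (classWeight (t i)) (Vec.insertAt-lookup T i b)))
        (∏-cong λ x → ≈-reflexive (cong (classWeight (t (punchIn i x))) (Vec.insertAt-punchIn T i b x))))

    weight-merge : ∀ {m} (t : Fin (suc m) → ℕ) i j T → compat (lookup T j) (lookup T j) * weight t (insertAt T i (lookup T j)) ≈
                   weight (Vector.updateAt (t ∘ punchIn i) j (t i ℕ.+_)) T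
    weight-merge t i j T = ≈-trans (*-congˡ (weight-insertAt t i T (lookup T j)))
      (≈-trans (≈-sym (*-assoc _ _ _)) (≈-sym (∏-update j
        (≈-trans (≈-reflexive (cong (λ s → classWeight s (lookup T j)) (Vector.updateAt-updates j (t ∘ punchIn i))))
          (classWeight-+ (t i) (t (punchIn i j)) (lookup T j)))
        (λ x x≢j → ≈-reflexive (cong (λ s → classWeight s (lookup T x)) (Vector.updateAt-minimal x j (t ∘ punchIn i) x≢j))))))

    -- Only the choice that puts the merged class i on the side of j contributes.
    select : ∀ b (F : Bool → Carrier) → F outside * compat outside b + F inside * compat inside b ≈ F b * compat b b
    select inside  F = ≈-trans (+-congʳ (zeroʳ _)) (+-identityˡ _)
    select outside F = ≈-trans (+-congˡ (zeroʳ _)) (+-identityʳ _)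

    -- The arbitrary factor `φ` makes the induction possible: the edge contracted last is moved into
    -- `φ` while the others are contracted. Its weight then depends only on the classes of its
    -- endpoints. If they coincide, it raises the count of that class; if not, it annihilates all
    -- terms in which the two classes are on different sides, and what remains is a sum over the
    -- merged classes.
    sum-over-classes : ∀ {P m c t} → Contraction G P {m} c t → (φ : Subset n → Carrier) →
      ∑ (λ S → φ S * (∏ˡ (edgeWeight S) P * weight (λ _ → 0) S)) ≈ ∑ (λ T → φ (pullback c T) * weight t T)
    sum-over-classes none φ = ∑ˡ-cong (λ S → *-cong (≈-reflexive (cong φ (sym (Vec.tabulate∘lookup S)))) (*-identityˡ _)) (subsets n)
    sum-over-classes {e ∷ P} {m} {c} (close {u = u} {v} {t = t} C e∉P j cu≡cv) φ = begin-equality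
      ∑ (λ S → φ S * ((edgeWeight S e * E S) * w S))       ≈⟨ ∑ˡ-cong (λ S → regroup (φ S) _ _ _) (subsets n) ⟩
      ∑ (λ S → (φ S * edgeWeight S e) * (E S * w S))       ≈⟨ sum-over-classes C (λ S → φ S * edgeWeight S e) ⟩
      ∑ (λ T → (φ (pullback c T) * edgeWeight (pullback c T) e) * weight t T)
        ≈⟨ ∑ˡ-cong (λ T → ≈-trans (*-assoc _ _ _) (*-congˡ (≈-trans
             (*-congʳ (≈-reflexive (trans (edgeWeight-pullback j c T) (cong (λ i → compat (lookup T (c u)) (lookup T i)) (sym cu≡cv)))))
             (weight-close t (c u) T)))) (subsets m) ⟩
      ∑ (λ T → φ (pullback c T) * weight (Vector.updateAt t (c u) suc) T)  ∎
      where
      E w : Subset n → Carrier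
      E S = ∏ˡ (edgeWeight S) P
      w = weight (λ _ → 0)
      regroup : ∀ a b c d → a * ((b * c) * d) ≈ (a * b) * (c * d)
      regroup = solve 4 (λ a b c d → a ⊕ ((b ⊕ c) ⊕ d) ⊜ (a ⊕ b) ⊕ (c ⊕ d)) ≈-refl
    sum-over-classes {e ∷ P} {m} (merge {u = u} {v} {c = c} {t = t} C e∉P j cu≢cv) φ = begin-equality
      ∑ (λ S → φ S * ((edgeWeight S e * E S) * w S))       ≈⟨ ∑ˡ-cong (λ S → regroup (φ S) _ _ _) (subsets n) ⟩
      ∑ (λ S → (φ S * edgeWeight S e) * (E S * w S))       ≈⟨ sum-over-classes C (λ S → φ S * edgeWeight S e) ⟩
      ∑ F                                                   ≈⟨ ∑-insertAt F i ⟩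
      ∑ (λ T → F (insertAt T i outside) + F (insertAt T i inside))
        ≈⟨ ∑ˡ-cong (λ T → ≈-trans (+-cong (F-insertAt T outside) (F-insertAt T inside)) (≈-trans (select (lookup T j′) (H T)) (survivor T))) (subsets m) ⟩
      ∑ (λ T → φ (pullback (glue cu≢cv ∘ c) T) * weight (Vector.updateAt (t ∘ punchIn i) j′ (t i ℕ.+_)) T)  ∎
      where
      E w : Subset n → Carrier
      E S = ∏ˡ (edgeWeight S) P
      w = weight (λ _ → 0)
      i = c u
      j′ = punchOut cu≢cv
      regroup : ∀ a b c d → a * ((b * c) * d) ≈ (a * b) * (c * d)
      regroup = solve 4 (λ a b c d → a ⊕ ((b ⊕ c) ⊕ d) ⊜ (a ⊕ b) ⊕ (c ⊕ d)) ≈-refl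
      F : Subset (suc m) → Carrier
      F T = (φ (pullback c T) * edgeWeight (pullback c T) e) * weight t T
      H : Subset m → Bool → Carrier
      H T b = φ (pullback c (insertAt T i b)) * weight t (insertAt T i b)
      lookup-j : ∀ T b → lookup (insertAt T i b) (c v) ≡ lookup T j′
      lookup-j T b = trans (cong (lookup (insertAt T i b)) (sym (Fin.punchIn-punchOut cu≢cv))) (Vec.insertAt-punchIn T i b j′)
      F-insertAt : ∀ T b → F (insertAt T i b) ≈ H T b * compat b (lookup T j′)
      F-insertAt T b = ≈-trans
        (*-congʳ (*-congˡ (≈-reflexive (trans (edgeWeight-pullback j c (insertAt T i b))
          (cong₂ compat (Vec.insertAt-lookup T i b) (lookup-j T b))))))
        (solve 3 (λ a b c → (a ⊕ b) ⊕ c ⊜ (a ⊕ c) ⊕ b) ≈-refl _ _ _)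
      survivor : ∀ T → H T (lookup T j′) * compat (lookup T j′) (lookup T j′) ≈
                 φ (pullback (glue cu≢cv ∘ c) T) * weight (Vector.updateAt (t ∘ punchIn i) j′ (t i ℕ.+_)) T
      survivor T = ≈-trans (solve 3 (λ a b c → (a ⊕ b) ⊕ c ⊜ a ⊕ (c ⊕ b)) ≈-refl _ _ _)
        (*-cong (≈-reflexive (cong φ (pullback-insertAt c cu≢cv T))) (weight-merge t i j′ T))

    -- The coefficient of `w ^ ∣ A ∣` in the expanded `Z²`. With all counts 0, `weight` gives a
    -- factor `r` for each vertex outside S.
    transfer : Subset size → Carrier
    transfer A = ∑ (λ S → ∏ˡ (edgeWeight S) (elements G A) * weight (λ _ → 0) S)

    transfer≈∏ : ∀ {A m c t} → Contraction G (elements G A) {m} c t → transfer A ≈ ∏ (λ i → r * ρ ^ t i + 1#)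
    transfer≈∏ {A} {m} {t = t} C = begin-equality
      transfer A                    ≈⟨ ∑ˡ-cong (λ S → *-identityˡ _) (subsets n) ⟨
      ∑ (λ S → 1# * (∏ˡ (edgeWeight S) (elements G A) * weight (λ _ → 0) S))  ≈⟨ sum-over-classes C (λ _ → 1#) ⟩
      ∑ (λ T → 1# * weight t T)     ≈⟨ ∑ˡ-cong (λ T → *-identityˡ _) (subsets m) ⟩
      ∑ (weight t)                  ≈⟨ ∑-∏ (λ i → classWeight (t i)) ⟩
      ∏ (λ i → r * ρ ^ t i + 1#)    ∎

    vertex-weight : ∀ {m} (S : Subset m) → r ^ ∣ ∁ S ∣ ≈ weight (λ _ → 0) S
    vertex-weight S = ≈-trans (∏-card r (∁ S)) (∏-cong λ i → ≈-trans
      (≈-reflexive (cong (λ b → if b then r else 1#) (Vec.lookup-map i not S))) (factor (lookup S i)))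
      where
      factor : ∀ b → (if not b then r else 1#) ≈ classWeight 0 b
      factor inside  = ≈-refl
      factor outside = ≈-sym (*-identityʳ r)

    Z² : Carrier → Carrier
    Z² w = ∑ λ S → (1# + w) ^ edgesIn G S * r ^ (n ℕ.∸ ∣ S ∣) * (1# + w * ρ) ^ edgesIn G (∁ S)

    -- An edge between S and its complement occurs in neither power, so its factor is 1; this is 1 +
    -- w · 0, whence the value 0 in `compat`.
    edge-factor : ∀ w a b → (if a ∧ b then 1# + w else 1#) * (if not a ∧ not b then 1# + w * ρ else 1#) ≈ 1# + w * compat a b
    edge-factor w inside  inside  = ≈-trans (*-identityʳ _) (+-congˡ (≈-sym (*-identityʳ w)))
    edge-factor w outside outside = *-identityˡ _
    edge-factor w inside  outside = ≈-trans (*-identityˡ _) (≈-sym (≈-trans (+-congˡ (zeroʳ w)) (+-identityʳ 1#)))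
    edge-factor w outside inside  = ≈-trans (*-identityˡ _) (≈-sym (≈-trans (+-congˡ (zeroʳ w)) (+-identityʳ 1#)))

    edge-powers : ∀ w S → (1# + w) ^ edgesIn G S * (1# + w * ρ) ^ edgesIn G (∁ S) ≈ ∏ (λ e → 1# + w * edgeWeight S e)
    edge-powers w S = begin-equality
      (1# + w) ^ edgesIn G S * (1# + w * ρ) ^ edgesIn G (∁ S)
        ≈⟨ *-cong (∏-count (inside? S) (1# + w)) (∏-count (inside? (∁ S)) (1# + w * ρ)) ⟩
      ∏ (λ e → if does (inside? S e) then 1# + w else 1#) * ∏ (λ e → if does (inside? (∁ S) e) then 1# + w * ρ else 1#)
        ≈⟨ ∏-distrib (λ e → if does (inside? S e) then 1# + w else 1#) (λ e → if does (inside? (∁ S) e) then 1# + w * ρ else 1#) ⟨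
      ∏ (λ e → (if does (inside? S e) then 1# + w else 1#) * (if does (inside? (∁ S) e) then 1# + w * ρ else 1#))
        ≈⟨ ∏-cong (λ e → ≈-trans
             (≈-reflexive (cong₂ (λ b b′ → (if b then 1# + w else 1#) * (if b′ then 1# + w * ρ else 1#))
               (cong₂ _∧_ (does-∈? _ S) (does-∈? _ S)) (cong₂ _∧_ (does-∈∁? _ S) (does-∈∁? _ S))))
             (edge-factor w (lookup S (proj₁ (ends e))) (lookup S (proj₂ (ends e))))) ⟩
      ∏ (λ e → 1# + w * edgeWeight S e)  ∎
      where
      inside? : (T : Subset n) (e : Fin size) → Dec _
      inside? T e = (proj₁ (ends e) ∈? T) ×-dec (proj₂ (ends e) ∈? T)
      does-∈∁? : (x : Fin n) (S : Subset n) → does (x ∈? ∁ S) ≡ not (lookup S x)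
      does-∈∁? x S = trans (does-∈? x (∁ S)) (Vec.lookup-map x not S)

    expand : ∀ w S → ∏ (λ e → 1# + w * edgeWeight S e) ≈ ∑ (λ A → w ^ ∣ A ∣ * ∏ˡ (edgeWeight S) (elements G A))
    expand w S = begin-equality
      ∏ (λ e → 1# + w * edgeWeight S e)   ≈⟨ ∑-∏ (λ e b → if b then w * edgeWeight S e else 1#) ⟨
      ∑ (λ A → ∏ (λ e → if lookup A e then w * edgeWeight S e else 1#))  ≈⟨ ∑ˡ-cong split (subsets size) ⟩
      ∑ (λ A → w ^ ∣ A ∣ * ∏ˡ (edgeWeight S) (elements G A))             ∎
      where
      if-* : ∀ b x y → (if b then x * y else 1#) ≈ (if b then x else 1#) * (if b then y else 1#)
      if-* true  x y = ≈-refl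
      if-* false x y = ≈-sym (*-identityˡ 1#)
      split : ∀ A → ∏ (λ e → if lookup A e then w * edgeWeight S e else 1#) ≈ w ^ ∣ A ∣ * ∏ˡ (edgeWeight S) (elements G A)
      split A = begin-equality
        ∏ (λ e → if lookup A e then w * edgeWeight S e else 1#)
          ≈⟨ ∏-cong (λ e → if-* (lookup A e) w (edgeWeight S e)) ⟩
        ∏ (λ e → (if lookup A e then w else 1#) * (if lookup A e then edgeWeight S e else 1#))
          ≈⟨ ∏-distrib (λ e → if lookup A e then w else 1#) (λ e → if lookup A e then edgeWeight S e else 1#) ⟩
        ∏ (λ e → if lookup A e then w else 1#) * ∏ (λ e → if lookup A e then edgeWeight S e else 1#)
          ≈⟨ *-cong (∏-card w A) (≈-trans (∏-filter (_∈? A) (edgeWeight S))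
               (∏-cong λ e → ≈-reflexive (cong (λ b → if b then edgeWeight S e else 1#) (does-∈? e A)))) ⟨
        w ^ ∣ A ∣ * ∏ˡ (edgeWeight S) (elements G A)  ∎

    Z²≈∑-transfer : ∀ w → Z² w ≈ ∑ (λ A → transfer A * w ^ ∣ A ∣)
    Z²≈∑-transfer w = begin-equality
      Z² w                                  ≈⟨ ∑ˡ-cong term (subsets n) ⟩
      ∑ (λ S → ∑ (λ A → w ^ ∣ A ∣ * (E A S * W S)))  ≈⟨ ∑ˡ-swap (λ S A → w ^ ∣ A ∣ * (E A S * W S)) (subsets n) (subsets size) ⟩
      ∑ (λ A → ∑ (λ S → w ^ ∣ A ∣ * (E A S * W S)))
        ≈⟨ ∑ˡ-cong (λ A → ≈-trans (*-comm _ _) (∑ˡ-*ˡ (w ^ ∣ A ∣) (λ S → E A S * W S) (subsets n))) (subsets size) ⟨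
      ∑ (λ A → transfer A * w ^ ∣ A ∣)      ∎
      where
      E : Subset size → Subset n → Carrier
      E A S = ∏ˡ (edgeWeight S) (elements G A)
      W : Subset n → Carrier
      W = weight (λ _ → 0)
      term : ∀ S → (1# + w) ^ edgesIn G S * r ^ (n ℕ.∸ ∣ S ∣) * (1# + w * ρ) ^ edgesIn G (∁ S) ≈ ∑ (λ A → w ^ ∣ A ∣ * (E A S * W S))
      term S = begin-equality
        (1# + w) ^ edgesIn G S * r ^ (n ℕ.∸ ∣ S ∣) * (1# + w * ρ) ^ edgesIn G (∁ S)
          ≈⟨ solve 3 (λ a b c → (a ⊕ b) ⊕ c ⊜ b ⊕ (a ⊕ c)) ≈-refl _ _ _ ⟩
        r ^ (n ℕ.∸ ∣ S ∣) * ((1# + w) ^ edgesIn G S * (1# + w * ρ) ^ edgesIn G (∁ S))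
          ≈⟨ *-cong (≈-trans (≈-reflexive (cong (r ^_) (sym (Subset.∣∁p∣≡n∸∣p∣ S)))) (vertex-weight S)) (≈-trans (edge-powers w S) (expand w S)) ⟩
        W S * ∑ (λ A → w ^ ∣ A ∣ * E A S)       ≈⟨ ∑ˡ-*ˡ (W S) (λ A → w ^ ∣ A ∣ * E A S) (subsets size) ⟩
        ∑ (λ A → W S * (w ^ ∣ A ∣ * E A S))
          ≈⟨ ∑ˡ-cong (λ A → solve 3 (λ a b c → a ⊕ (b ⊕ c) ⊜ b ⊕ (c ⊕ a)) ≈-refl (W S) (w ^ ∣ A ∣) (E A S)) (subsets size) ⟩
        ∑ (λ A → w ^ ∣ A ∣ * (E A S * W S))     ∎

    -- Term by term comparison of the two sums

    module _ (0≤r : 0# ≤ r) (0≤ρ : 0# ≤ ρ) (ρ≤1 : ρ ≤ 1#) {q : Carrier} (q≈r+1 : q ≈ r + 1#) where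

      private
        0≤q : 0# ≤ q
        0≤q = ≤-trans (+-nonneg 0≤r 0≤1) (≤-reflexive (≈-sym q≈r+1))
        0≤rρ^ : ∀ s → 0# ≤ r * ρ ^ s
        0≤rρ^ s = *-nonneg 0≤r (^-nonneg s 0≤ρ)

      q^k≈∏ : ∀ {A m c t} → Contraction G (elements G A) {m} c t → q ^ k G A ≈ ∏ {m} (λ _ → q)
      q^k≈∏ {m = m} C = ≈-trans (≈-reflexive (cong (q ^_) (k≡classes G C))) (≈-sym (∏-replicate m))

      transfer≤q^k : ∀ A → transfer A ≤ q ^ k G A
      transfer≤q^k A with contract G (elements G A) (elements-unique G A)
      ... | m , c , t , C = begin
        transfer A                   ≈⟨ transfer≈∏ C ⟩
        ∏ (λ i → r * ρ ^ t i + 1#)   ∼⟨ ∏-mono (λ i → +-nonneg (0≤rρ^ (t i)) 0≤1) (λ i → factor≤q (t i)) ⟩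
        ∏ {m} (λ _ → q)              ≈⟨ q^k≈∏ C ⟨
        q ^ k G A                    ∎
        where
        factor≤q : ∀ s → r * ρ ^ s + 1# ≤ q
        factor≤q s = begin
          r * ρ ^ s + 1#  ∼⟨ +-mono (*-monoˡ 0≤r (^-≤1 s 0≤ρ ρ≤1)) ≤-refl ⟩
          r * 1# + 1#     ≈⟨ +-congʳ (*-identityʳ r) ⟩
          r + 1#          ≈⟨ q≈r+1 ⟨
          q               ∎

      -- Each class is charged `cost`: nothing for a tree, whose factor is already `q`, and a factor
      -- `q` for a class with a cycle, whose own factor is bounded below by 1. The total charge is
      -- `q` to the number of cyclic classes, one of the powers that `Q` bounds.
      q^k≤transfer : ∀ g {Q} → (∀ b → b ℕ.* g ℕ.≤ n ℕ.+ L G g ℕ.* g → q ^ b ≤ Q) → ∀ A → q ^ k G A ≤ Q * transfer A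
      q^k≤transfer g {Q} q^b≤Q A with contract G (elements G A) (elements-unique G A)
      ... | m , c , t , C = begin
        q ^ k G A                     ≈⟨ q^k≈∏ C ⟩
        ∏ {m} (λ _ → q)               ∼⟨ ∏-mono (λ _ → 0≤q) (λ i → q≤factor (t i)) ⟩
        ∏ (λ i → cost (t i) * (r * ρ ^ t i + 1#))
          ≈⟨ ∏-distrib (cost ∘ t) (λ i → r * ρ ^ t i + 1#) ⟩
        ∏ (cost ∘ t) * ∏ (λ i → r * ρ ^ t i + 1#)
          ≈⟨ *-cong (∏-count (λ i → 0 ℕ.<? t i) q) (transfer≈∏ C) ⟨
        q ^ length (cyclic-classes G t) * transfer A
          ∼⟨ *-mono 0≤transfer 0≤Q (q^b≤Q (length (cyclic-classes G t)) (cyclic-classes*g≤ G C g)) ≤-refl ⟩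
        Q * transfer A                ∎
        where
        cost : ℕ → Carrier
        cost s = if does (0 ℕ.<? s) then q else 1#
        q≤factor : ∀ s → q ≤ cost s * (r * ρ ^ s + 1#)
        q≤factor zero = ≤-reflexive (≈-trans q≈r+1 (≈-trans (+-congʳ (≈-sym (*-identityʳ r))) (≈-sym (*-identityˡ _))))
        q≤factor (suc s) = begin
          q                               ≈⟨ *-identityʳ q ⟨
          q * 1#                          ≈⟨ *-congˡ (+-identityˡ 1#) ⟨
          q * (0# + 1#)                   ∼⟨ *-monoˡ 0≤q (+-mono (0≤rρ^ (suc s)) ≤-refl) ⟩
          q * (r * ρ ^ suc s + 1#)        ∎
        0≤Q : 0# ≤ Q
        -- The exponent b = 0 is always admissible, so `Q` is at least 1.
        0≤Q = ≤-trans 0≤1 (q^b≤Q 0 ℕ.z≤n)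
        0≤transfer : 0# ≤ transfer A
        0≤transfer = ≤-trans (∏-nonneg (λ i → +-nonneg (0≤rρ^ (t i)) 0≤1)) (≤-reflexive (≈-sym (transfer≈∏ C)))

      module _ {w : Carrier} (0≤w : 0# ≤ w) where

        Z²≤Z : Z² w ≤ ∑ (λ A → q ^ k G A * w ^ ∣ A ∣)
        Z²≤Z = begin
          Z² w                               ≈⟨ Z²≈∑-transfer w ⟩
          ∑ (λ A → transfer A * w ^ ∣ A ∣)   ∼⟨ ∑ˡ-mono (λ A → *-mono-≤ʳ A (transfer≤q^k A)) (subsets size) ⟩
          ∑ (λ A → q ^ k G A * w ^ ∣ A ∣)    ∎
          where
          *-mono-≤ʳ : ∀ A {x y} → x ≤ y → x * w ^ ∣ A ∣ ≤ y * w ^ ∣ A ∣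
          *-mono-≤ʳ A x≤y = ≤-trans (≤-reflexive (*-comm _ _)) (≤-trans (*-monoˡ (^-nonneg ∣ A ∣ 0≤w) x≤y) (≤-reflexive (*-comm _ _)))

        Z≤Q*Z² : ∀ g {Q} → (∀ b → b ℕ.* g ℕ.≤ n ℕ.+ L G g ℕ.* g → q ^ b ≤ Q) → ∑ (λ A → q ^ k G A * w ^ ∣ A ∣) ≤ Q * Z² w
        Z≤Q*Z² g {Q} q^b≤Q = begin
          ∑ (λ A → q ^ k G A * w ^ ∣ A ∣)         ∼⟨ ∑ˡ-mono term (subsets size) ⟩
          ∑ (λ A → Q * (transfer A * w ^ ∣ A ∣))  ≈⟨ ∑ˡ-*ˡ Q (λ A → transfer A * w ^ ∣ A ∣) (subsets size) ⟨
          Q * ∑ (λ A → transfer A * w ^ ∣ A ∣)    ≈⟨ *-congˡ (Z²≈∑-transfer w) ⟨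
          Q * Z² w                                ∎
          where
          term : ∀ A → q ^ k G A * w ^ ∣ A ∣ ≤ Q * (transfer A * w ^ ∣ A ∣)
          term A = begin
            q ^ k G A * w ^ ∣ A ∣            ≈⟨ *-comm _ _ ⟩
            w ^ ∣ A ∣ * q ^ k G A            ∼⟨ *-monoˡ (^-nonneg ∣ A ∣ 0≤w) (q^k≤transfer g q^b≤Q A) ⟩
            w ^ ∣ A ∣ * (Q * transfer A)     ≈⟨ solve 3 (λ a b c → a ⊕ (b ⊕ c) ⊜ b ⊕ (c ⊕ a)) ≈-refl _ _ _ ⟩
            Q * (transfer A * w ^ ∣ A ∣)     ∎

-- The operations are separate parameters, and the power function is one of them, so
-- that at ℝ the sums below are literally those of Z and Z⁽²⁾: comparing two different
-- expressions for a real number would unfold their Cauchy proofs.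
module OrderedSemiringBounds {Carrier : Set} {_≈_ _≤_ : Rel Carrier 0ℓ} {_+_ _*_ : Op₂ Carrier} {0# 1# : Carrier}
  (isCommutativeSemiring : IsCommutativeSemiring _≈_ _+_ _*_ 0# 1#)
  (isPreorder : IsPreorder _≈_ _≤_)
  (+-mono : ∀ {x y z u} → x ≤ y → z ≤ u → (x + z) ≤ (y + u))
  (*-monoˡ : ∀ {x y z} → 0# ≤ z → x ≤ y → (z * x) ≤ (z * y))
  (0≤1 : 0# ≤ 1#)
  (_^_ : Carrier → ℕ → Carrier)
  (^-zero : ∀ x → (x ^ 0) ≡ 1#)
  (^-suc : ∀ x m → (x ^ suc m) ≡ (x * (x ^ m)))
  where

  R : OrderedCommutativeSemiring
  R = record
    { commutativeSemiring = record { isCommutativeSemiring = isCommutativeSemiring }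
    ; _≤_ = _≤_ ; isPreorder = isPreorder ; +-mono = +-mono ; *-monoˡ = *-monoˡ ; 0≤1 = 0≤1 }

  open CommutativeSemiring (OrderedCommutativeSemiring.commutativeSemiring R) using (semiring)
  open OrderedSemiring R
  import Algebra.Properties.Semiring.Exp semiring as Exp
  open IsPreorder isPreorder using () renaming (trans to ≤-trans; reflexive to ≤-reflexive)

  ^≡Exp : ∀ x m → (x ^ m) ≡ (x Exp.^ m)
  ^≡Exp x zero    = ^-zero x
  ^≡Exp x (suc m) = trans (^-suc x m) (cong (x *_) (^≡Exp x m))

  ^-monoˡ : ∀ x y m → 0# ≤ x → x ≤ y → (x ^ m) ≤ (y ^ m)
  ^-monoˡ x y m 0≤x x≤y = subst₂ _≤_ (sym (^≡Exp x m)) (sym (^≡Exp y m)) (^-mono m 0≤x x≤y)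

  -- Meant for `y` the `d`-th root of `x`: then `y ^ a` is x^(a/d), and b ≤ a/d is the inequality
  -- `d ℕ.* b ℕ.≤ a`.
  ^-≤-^ : ∀ x y b d a → 0# ≤ x → 1# ≤ y → x ≤ (y ^ d) → d ℕ.* b ℕ.≤ a → (x ^ b) ≤ (y ^ a)
  ^-≤-^ x y b d a 0≤x 1≤y x≤y^d db≤a = subst₂ _≤_ (sym (^≡Exp x b)) (sym (^≡Exp y a))
    (≤-trans (^-mono b 0≤x (subst (x ≤_) (^≡Exp y d) x≤y^d))
      (≤-trans (≤-reflexive (Exp.^-assocʳ y d b)) (^-monoʳ 1≤y db≤a)))

  module _ {n} (G : Graph n) (q r ρ w : Carrier) where
    open Graph G

    Z Z⁽²⁾ : Carrier
    Z = foldr _+_ 0# (List.map (λ A → (q ^ k G A) * (w ^ ∣ A ∣)) (subsets size))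
    Z⁽²⁾ = foldr _+_ 0# (List.map (λ S → (((1# + w) ^ edgesIn G S) * (r ^ (n ℕ.∸ ∣ S ∣))) * ((1# + (w * ρ)) ^ edgesIn G (∁ S))) (subsets n))

    module _ (rρ≈1 : (r * ρ) ≈ 1#) (0≤r : 0# ≤ r) (0≤ρ : 0# ≤ ρ) (ρ≤1 : ρ ≤ 1#) (q≈r+1 : q ≈ (r + 1#)) (0≤w : 0# ≤ w) where

      private
        Z≡ : Z ≡ ∑ (λ A → (q Exp.^ k G A) * (w Exp.^ ∣ A ∣))
        Z≡ = cong (foldr _+_ 0#) (List.map-cong (λ A → cong₂ _*_ (^≡Exp q (k G A)) (^≡Exp w ∣ A ∣)) (subsets size))
        Z⁽²⁾≡ : Z⁽²⁾ ≡ Z² G r ρ rρ≈1 w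
        Z⁽²⁾≡ = cong (foldr _+_ 0#) (List.map-cong (λ S → cong₂ _*_
          (cong₂ _*_ (^≡Exp (1# + w) (edgesIn G S)) (^≡Exp r (n ℕ.∸ ∣ S ∣))) (^≡Exp (1# + (w * ρ)) (edgesIn G (∁ S)))) (subsets n))

      Z⁽²⁾≤Z : Z⁽²⁾ ≤ Z
      Z⁽²⁾≤Z = subst₂ _≤_ (sym Z⁽²⁾≡) (sym Z≡) (Z²≤Z G r ρ rρ≈1 0≤r 0≤ρ ρ≤1 q≈r+1 0≤w)

      Z≤Q*Z⁽²⁾ : ∀ g Q → (∀ b → b ℕ.* g ℕ.≤ n ℕ.+ L G g ℕ.* g → (q ^ b) ≤ Q) → Z ≤ (Q * Z⁽²⁾)
      Z≤Q*Z⁽²⁾ g Q q^b≤Q = subst₂ (λ x y → x ≤ (Q * y)) (sym Z≡) (sym Z⁽²⁾≡)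
        (Z≤Q*Z² G r ρ rρ≈1 0≤r 0≤ρ ρ≤1 q≈r+1 0≤w g λ b bg≤ → subst (_≤ Q) (^≡Exp q b) (q^b≤Q b bg≤))

-- The real numbers as an ordered commutative semiring

open import Defs
open Rational
open ℚ.≤-Reasoning

infix 4 _≈_
-- Terms may differ as long as the difference tends to 0. A real times its reciprocal is 1 only in
-- this sense, because `recip` drops initial terms.
_≈_ : ℝ → ℝ → Set
x ≈ y = ∀ δ → 0ℚ ℚ.< δ → ∃[ N ] ∀ i → N ℕ.≤ i → ℚ.∣ seq x i ℚ.- seq y i ∣ ℚ.< δ

pointwise⇒≈ : ∀ x y → (∀ i → seq x i ≡ seq y i) → x ≈ y
pointwise⇒≈ x y eq δ 0<δ = 0 , λ i _ → begin-strict
  ℚ.∣ seq x i ℚ.- seq y i ∣  ≡⟨ cong (λ z → ℚ.∣ z ℚ.- seq y i ∣) (eq i) ⟩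
  ℚ.∣ seq y i ℚ.- seq y i ∣  ≡⟨ cong ℚ.∣_∣ (ℚ.+-inverseʳ (seq y i)) ⟩
  0ℚ                         <⟨ 0<δ ⟩
  δ                          ∎

≈-sym : ∀ x y → x ≈ y → y ≈ x
≈-sym x y x≈y δ 0<δ with x≈y δ 0<δ
... | N , h = N , λ i Ni → subst (ℚ._< δ) (∣-∣-swap (seq x i) (seq y i)) (h i Ni)

≈-trans : ∀ x y z → x ≈ y → y ≈ z → x ≈ z
≈-trans x y z x≈y y≈z δ 0<δ with x≈y (½ ℚ.* δ) (half-pos 0<δ) | y≈z (½ ℚ.* δ) (half-pos 0<δ)
... | M , hM | N , hN = M ℕ.⊔ N , λ i mi → begin-strict
  ℚ.∣ seq x i ℚ.- seq z i ∣
    ≡⟨ cong ℚ.∣_∣ (solve 3 (λ a b c → a :- c := (a :- b) :+ (b :- c)) refl (seq x i) (seq y i) (seq z i)) ⟩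
  ℚ.∣ (seq x i ℚ.- seq y i) ℚ.+ (seq y i ℚ.- seq z i) ∣  ≤⟨ ℚ.∣p+q∣≤∣p∣+∣q∣ (seq x i ℚ.- seq y i) (seq y i ℚ.- seq z i) ⟩
  ℚ.∣ seq x i ℚ.- seq y i ∣ ℚ.+ ℚ.∣ seq y i ℚ.- seq z i ∣
    <⟨ ℚ.+-mono-< (hM i (⊔-left M N mi)) (hN i (⊔-right M N mi)) ⟩
  ½ ℚ.* δ ℚ.+ ½ ℚ.* δ  ≡⟨ halves δ ⟩
  δ                    ∎
  where open +-*-Solver

+-cong : ∀ x x′ y y′ → x ≈ x′ → y ≈ y′ → x + y ≈ x′ + y′
+-cong x x′ y y′ x≈x′ y≈y′ δ 0<δ with x≈x′ (½ ℚ.* δ) (half-pos 0<δ) | y≈y′ (½ ℚ.* δ) (half-pos 0<δ)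
... | M , hM | N , hN = M ℕ.⊔ N , λ i mi → begin-strict
  ℚ.∣ (seq x i ℚ.+ seq y i) ℚ.- (seq x′ i ℚ.+ seq y′ i) ∣
    ≡⟨ cong ℚ.∣_∣ (solve 4 (λ a b c d → (a :+ b) :- (c :+ d) := (a :- c) :+ (b :- d)) refl (seq x i) (seq y i) (seq x′ i) (seq y′ i)) ⟩
  ℚ.∣ (seq x i ℚ.- seq x′ i) ℚ.+ (seq y i ℚ.- seq y′ i) ∣  ≤⟨ ℚ.∣p+q∣≤∣p∣+∣q∣ (seq x i ℚ.- seq x′ i) (seq y i ℚ.- seq y′ i) ⟩
  ℚ.∣ seq x i ℚ.- seq x′ i ∣ ℚ.+ ℚ.∣ seq y i ℚ.- seq y′ i ∣
    <⟨ ℚ.+-mono-< (hM i (⊔-left M N mi)) (hN i (⊔-right M N mi)) ⟩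
  ½ ℚ.* δ ℚ.+ ½ ℚ.* δ  ≡⟨ halves δ ⟩
  δ                    ∎
  where open +-*-Solver

*-cong : ∀ x x′ y y′ → x ≈ x′ → y ≈ y′ → x * y ≈ x′ * y′
*-cong x x′ y y′ x≈x′ y≈y′ δ 0<δ =
  let B , 0<B , K , hK = eventually-bounded {seq x} (cauchy x)
      C , 0<C , L , hL = eventually-bounded {seq y′} (cauchy y′)
      -- From x y - x′ y′ = x (y - y′) + y′ (x - x′): with `B` bounding x and `C` bounding y′, the
      -- tolerances δ / (2 C) and δ / (2 B) give δ / 2 for each summand.
      M , hM = x≈x′ (½ ℚ.* δ ℚ.* inv C 0<C) (*-pos (half-pos 0<δ) (inv-pos C 0<C))
      N , hN = y≈y′ (½ ℚ.* δ ℚ.* inv B 0<B) (*-pos (half-pos 0<δ) (inv-pos B 0<B))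
      KL = K ℕ.⊔ L
      MN = M ℕ.⊔ N
  in KL ℕ.⊔ MN , λ i mi → subst (ℚ.∣ seq x i ℚ.* seq y i ℚ.- seq x′ i ℚ.* seq y′ i ∣ ℚ.<_)
    (trans (cong₂ ℚ._+_ (scaled {B} (½ ℚ.* δ) (*-inv B 0<B)) (scaled {C} (½ ℚ.* δ) (*-inv C 0<C))) (halves δ))
    (*-close {seq x i} {seq y i} {seq x′ i} {seq y′ i} 0<B 0<C
      (hK i (⊔-left K L (⊔-left KL MN mi))) (hL i (⊔-right K L (⊔-left KL MN mi)))
      (hN i (⊔-right M N (⊔-right KL MN mi))) (hM i (⊔-left M N (⊔-right KL MN mi))))

≈⇒≤ : ∀ x y → x ≈ y → x ≤ y
≈⇒≤ x y x≈y δ 0<δ with x≈y δ 0<δ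
... | N , h = N , λ i Ni → ℚ.<⇒≤ (∣-∣<⇒<+ {seq x i} {seq y i} (h i Ni))

pointwise⇒≤ : ∀ x y → (∀ i → seq x i ℚ.≤ seq y i) → x ≤ y
pointwise⇒≤ x y le δ 0<δ = 0 , λ i _ → begin
  seq x i         ≤⟨ le i ⟩
  seq y i         ≡⟨ ℚ.+-identityʳ _ ⟨
  seq y i ℚ.+ 0ℚ  ≤⟨ ℚ.+-monoʳ-≤ (seq y i) (ℚ.<⇒≤ 0<δ) ⟩
  seq y i ℚ.+ δ   ∎

≤-trans : ∀ x y z → x ≤ y → y ≤ z → x ≤ z
≤-trans x y z x≤y y≤z δ 0<δ with x≤y (½ ℚ.* δ) (half-pos 0<δ) | y≤z (½ ℚ.* δ) (half-pos 0<δ)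
... | M , hM | N , hN = M ℕ.⊔ N , λ i mi → begin
  seq x i                                  ≤⟨ hM i (⊔-left M N mi) ⟩
  seq y i ℚ.+ ½ ℚ.* δ                      ≤⟨ ℚ.+-monoˡ-≤ (½ ℚ.* δ) (hN i (⊔-right M N mi)) ⟩
  seq z i ℚ.+ ½ ℚ.* δ ℚ.+ ½ ℚ.* δ          ≡⟨ ℚ.+-assoc (seq z i) _ _ ⟩
  seq z i ℚ.+ (½ ℚ.* δ ℚ.+ ½ ℚ.* δ)        ≡⟨ cong (seq z i ℚ.+_) (halves δ) ⟩
  seq z i ℚ.+ δ                            ∎

+-mono : ∀ x x′ y y′ → x ≤ x′ → y ≤ y′ → x + y ≤ x′ + y′
+-mono x x′ y y′ x≤x′ y≤y′ δ 0<δ with x≤x′ (½ ℚ.* δ) (half-pos 0<δ) | y≤y′ (½ ℚ.* δ) (half-pos 0<δ)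
... | M , hM | N , hN = M ℕ.⊔ N , λ i mi → begin
  seq x i ℚ.+ seq y i                                      ≤⟨ ℚ.+-mono-≤ (hM i (⊔-left M N mi)) (hN i (⊔-right M N mi)) ⟩
  (seq x′ i ℚ.+ ½ ℚ.* δ) ℚ.+ (seq y′ i ℚ.+ ½ ℚ.* δ)        ≡⟨ regroup (seq x′ i) (seq y′ i) (½ ℚ.* δ) ⟩
  (seq x′ i ℚ.+ seq y′ i) ℚ.+ (½ ℚ.* δ ℚ.+ ½ ℚ.* δ)        ≡⟨ cong (seq x′ i ℚ.+ seq y′ i ℚ.+_) (halves δ) ⟩
  (seq x′ i ℚ.+ seq y′ i) ℚ.+ δ                            ∎
  where
  open +-*-Solver
  regroup : ∀ a b h → (a ℚ.+ h) ℚ.+ (b ℚ.+ h) ≡ (a ℚ.+ b) ℚ.+ (h ℚ.+ h)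
  regroup = solve 3 (λ a b h → (a :+ h) :+ (b :+ h) := (a :+ b) :+ (h :+ h)) refl

-- From 0 ≤ (z + η) (y - x + η′), with η and η′ small against bounds for y - x and z.
*-monoˡ : ∀ x y z → 0ℝ ≤ z → x ≤ y → z * x ≤ z * y
*-monoˡ x y z 0≤z x≤y δ 0<δ =
  let B , 0<B , K , hK = eventually-bounded {seq z} (cauchy z)
      C , 0<C , L , hL = eventually-bounded {seq (y - x)} (cauchy (y - x))
      η = ½ ℚ.* δ ℚ.* inv C 0<C
      0<η = *-pos (half-pos 0<δ) (inv-pos C 0<C)
      0<B+η = ℚ.+-mono-< {0ℚ} {B} {0ℚ} {η} 0<B 0<η
      η′ = ½ ℚ.* δ ℚ.* inv (B ℚ.+ η) 0<B+η
      0<η′ = *-pos (half-pos 0<δ) (inv-pos (B ℚ.+ η) 0<B+η)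
      M , hM = 0≤z η 0<η
      N , hN = x≤y η′ 0<η′
      KL = K ℕ.⊔ L
      MN = M ℕ.⊔ N
  in KL ℕ.⊔ MN , λ i mi → bound-product (seq x i) (seq y i) (seq z i) (ℚ.<⇒≤ 0<η) (ℚ.<⇒≤ 0<η′)
    (ℚ.≤-trans (x≤∣x∣ (seq z i)) (hK i (⊔-left K L (⊔-left KL MN mi))))
    (ℚ.≤-trans (x≤∣x∣ (seq y i ℚ.- seq x i)) (hL i (⊔-right K L (⊔-left KL MN mi))))
    (hM i (⊔-left M N (⊔-right KL MN mi))) (hN i (⊔-right M N (⊔-right KL MN mi)))
    (scaled {C} (½ ℚ.* δ) (*-inv C 0<C)) (scaled {B ℚ.+ η} (½ ℚ.* δ) (*-inv (B ℚ.+ η) 0<B+η))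
  where
  bound-product : ∀ a b c {B C η η′} → 0ℚ ℚ.≤ η → 0ℚ ℚ.≤ η′ → c ℚ.≤ B → b ℚ.- a ℚ.≤ C →
    0ℚ ℚ.≤ c ℚ.+ η → a ℚ.≤ b ℚ.+ η′ → C ℚ.* η ≡ ½ ℚ.* δ → (B ℚ.+ η) ℚ.* η′ ≡ ½ ℚ.* δ → c ℚ.* a ℚ.≤ c ℚ.* b ℚ.+ δ
  bound-product a b c {B} {C} {η} {η′} 0≤η 0≤η′ c≤B b-a≤C 0≤c+η a≤b+η′ Cη Bη′ = begin
    c ℚ.* a                                                       ≡⟨ split a c η ⟩
    (c ℚ.+ η) ℚ.* a ℚ.- η ℚ.* a
      ≤⟨ ℚ.+-monoˡ-≤ (ℚ.- (η ℚ.* a)) (ℚ.*-monoˡ-≤-nonNeg (c ℚ.+ η) {{ℚ.nonNegative 0≤c+η}} a≤b+η′) ⟩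
    (c ℚ.+ η) ℚ.* (b ℚ.+ η′) ℚ.- η ℚ.* a                          ≡⟨ collect a b c η η′ ⟩
    c ℚ.* b ℚ.+ ((b ℚ.- a) ℚ.* η ℚ.+ (c ℚ.+ η) ℚ.* η′)
      ≤⟨ ℚ.+-monoʳ-≤ (c ℚ.* b) (ℚ.+-mono-≤
           (ℚ.*-monoʳ-≤-nonNeg η {{ℚ.nonNegative 0≤η}} b-a≤C)
           (ℚ.*-monoʳ-≤-nonNeg η′ {{ℚ.nonNegative 0≤η′}} (ℚ.+-monoˡ-≤ η c≤B))) ⟩
    c ℚ.* b ℚ.+ (C ℚ.* η ℚ.+ (B ℚ.+ η) ℚ.* η′)                    ≡⟨ cong (c ℚ.* b ℚ.+_) (trans (cong₂ ℚ._+_ Cη Bη′) (halves δ)) ⟩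
    c ℚ.* b ℚ.+ δ                                                 ∎
    where
    open +-*-Solver
    split : ∀ a c η → c ℚ.* a ≡ (c ℚ.+ η) ℚ.* a ℚ.- η ℚ.* a
    split = solve 3 (λ a c η → c :* a := (c :+ η) :* a :- η :* a) refl
    collect : ∀ a b c η η′ → (c ℚ.+ η) ℚ.* (b ℚ.+ η′) ℚ.- η ℚ.* a ≡ c ℚ.* b ℚ.+ ((b ℚ.- a) ℚ.* η ℚ.+ (c ℚ.+ η) ℚ.* η′)
    collect = solve 5 (λ a b c η η′ → (c :+ η) :* (b :+ η′) :- η :* a := c :* b :+ ((b :- a) :* η :+ (c :+ η) :* η′)) refl

ℝ-isEquivalence : IsEquivalence _≈_
ℝ-isEquivalence = record
  { refl  = λ {x} → pointwise⇒≈ x x λ _ → refl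
  ; sym   = λ {x} {y} → ≈-sym x y
  ; trans = λ {x} {y} {z} → ≈-trans x y z
  }

ℝ-isCommutativeSemiring : IsCommutativeSemiring _≈_ _+_ _*_ 0ℝ 1ℝ
ℝ-isCommutativeSemiring = record
  { isSemiring = record
    { isSemiringWithoutAnnihilatingZero = record
      { +-isCommutativeMonoid = record
        { isMonoid = record
          { isSemigroup = record
            { isMagma = record
              { isEquivalence = ℝ-isEquivalence ; ∙-cong = λ {x} {x′} {y} {y′} → +-cong x x′ y y′ }
            ; assoc = λ x y z → pointwise⇒≈ (x + y + z) (x + (y + z)) λ i → ℚ.+-assoc (seq x i) (seq y i) (seq z i)
            }
          ; identity = (λ x → pointwise⇒≈ (0ℝ + x) x λ i → ℚ.+-identityˡ (seq x i))
                     , (λ x → pointwise⇒≈ (x + 0ℝ) x λ i → ℚ.+-identityʳ (seq x i))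
          }
        ; comm = λ x y → pointwise⇒≈ (x + y) (y + x) λ i → ℚ.+-comm (seq x i) (seq y i)
        }
      ; *-cong = λ {x} {x′} {y} {y′} → *-cong x x′ y y′
      ; *-assoc = λ x y z → pointwise⇒≈ (x * y * z) (x * (y * z)) λ i → ℚ.*-assoc (seq x i) (seq y i) (seq z i)
      ; *-identity = (λ x → pointwise⇒≈ (1ℝ * x) x λ i → ℚ.*-identityˡ (seq x i))
                   , (λ x → pointwise⇒≈ (x * 1ℝ) x λ i → ℚ.*-identityʳ (seq x i))
      ; distrib = (λ x y z → pointwise⇒≈ (x * (y + z)) (x * y + x * z) λ i → ℚ.*-distribˡ-+ (seq x i) (seq y i) (seq z i))
                , (λ x y z → pointwise⇒≈ ((y + z) * x) (y * x + z * x) λ i → ℚ.*-distribʳ-+ (seq x i) (seq y i) (seq z i))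
      }
    ; zero = (λ x → pointwise⇒≈ (0ℝ * x) 0ℝ λ i → ℚ.*-zeroˡ (seq x i))
           , (λ x → pointwise⇒≈ (x * 0ℝ) 0ℝ λ i → ℚ.*-zeroʳ (seq x i))
    }
  ; *-comm = λ x y → pointwise⇒≈ (x * y) (y * x) λ i → ℚ.*-comm (seq x i) (seq y i)
  }

ℝ-isPreorder : IsPreorder _≈_ _≤_
ℝ-isPreorder = record
  { isEquivalence = ℝ-isEquivalence
  ; reflexive     = λ {x} {y} → ≈⇒≤ x y
  ; trans         = λ {x} {y} {z} → ≤-trans x y z
  }

module ℝ-Bounds = OrderedSemiringBounds {ℝ} {_≈_} {_≤_} {_+_} {_*_} {0ℝ} {1ℝ} ℝ-isCommutativeSemiring ℝ-isPreorder
  (λ {x} {y} {z} {u} → +-mono x y z u) (λ {x} {y} {z} → *-monoˡ x y z) (pointwise⇒≤ 0ℝ 1ℝ λ _ → ℚ.nonNegative⁻¹ 1ℚ)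
  _^_ (λ _ → refl) (λ _ _ → refl)

-- Reciprocals

module _ (x : ℝ) (0<x : 0ℝ < x) where

  private
    shift = proj₁ (proj₂ (proj₂ 0<x))

  0<shifted : ∀ i → 0ℚ ℚ.< seq x (shift ℕ.+ i)
  0<shifted i = let c , 0<c , N , h = 0<x in
    ℚ.<-≤-trans 0<c (subst (ℚ._≤ seq x (N ℕ.+ i)) (ℚ.+-identityˡ c) (h (N ℕ.+ i) (ℕ.m≤m+n N i)))

  shifted-*-recip : ∀ i → seq x (shift ℕ.+ i) ℚ.* seq (recip x 0<x) i ≡ 1ℚ
  shifted-*-recip i = *-inv (seq x (shift ℕ.+ i)) (0<shifted i)

  0≤recip : 0ℝ ≤ recip x 0<x
  0≤recip = pointwise⇒≤ 0ℝ (recip x 0<x) λ i → ℚ.<⇒≤ (inv-pos (seq x (shift ℕ.+ i)) (0<shifted i))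

  -- The reciprocal y is exact for the shifted sequence x′, so x y - 1 = y (x - x′). Here y is
  -- bounded, and x - x′ tends to 0 by the Cauchy property of x.
  *-recip : x * recip x 0<x ≈ 1ℝ
  *-recip δ 0<δ =
    let B , 0<B , K , hK = eventually-bounded {seq (recip x 0<x)} (cauchy (recip x 0<x))
        M , hM = cauchy x (δ ℚ.* inv B 0<B) (*-pos 0<δ (inv-pos B 0<B))
    in K ℕ.⊔ M , λ i mi →
      let y = seq (recip x 0<x) i
          x′ = seq x (shift ℕ.+ i)
          d = seq x i ℚ.- x′
      in begin-strict
        ℚ.∣ seq x i ℚ.* y ℚ.- 1ℚ ∣         ≡⟨ cong (λ z → ℚ.∣ seq x i ℚ.* y ℚ.- z ∣) (shifted-*-recip i) ⟨
        ℚ.∣ seq x i ℚ.* y ℚ.- x′ ℚ.* y ∣   ≡⟨ cong ℚ.∣_∣ (factor (seq x i) x′ y) ⟩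
        ℚ.∣ y ℚ.* d ∣                      ≡⟨ ℚ.∣p*q∣≡∣p∣*∣q∣ y d ⟩
        ℚ.∣ y ∣ ℚ.* ℚ.∣ d ∣                ≤⟨ ℚ.*-monoʳ-≤-nonNeg ℚ.∣ d ∣ {{ℚ.∣-∣-nonNeg d}} (hK i (⊔-left K M mi)) ⟩
        B ℚ.* ℚ.∣ d ∣
          <⟨ *-monoˡ-< {ℚ.∣ d ∣} {δ ℚ.* inv B 0<B} {B} 0<B
               (hM i (shift ℕ.+ i) (⊔-right K M mi) (ℕ.≤-trans (⊔-right K M mi) (ℕ.m≤n+m i shift))) ⟩
        B ℚ.* (δ ℚ.* inv B 0<B)            ≡⟨ scaled {B} δ (*-inv B 0<B) ⟩
        δ                                  ∎
    where
    open +-*-Solver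
    factor : ∀ a b y → a ℚ.* y ℚ.- b ℚ.* y ≡ y ℚ.* (a ℚ.- b)
    factor = solve 3 (λ a b y → a :* y :- b :* y := y :* (a :- b)) refl

  -- Multiply 1 ≤ x by the nonnegative reciprocal.
  recip≤1 : 1ℝ ≤ x → recip x 0<x ≤ 1ℝ
  recip≤1 1≤x = ≤-trans (recip x 0<x) (recip x 0<x * 1ℝ) 1ℝ
    (≈⇒≤ (recip x 0<x) (recip x 0<x * 1ℝ) (pointwise⇒≈ (recip x 0<x) (recip x 0<x * 1ℝ) λ i → sym (ℚ.*-identityʳ (seq (recip x 0<x) i))))
    (≤-trans (recip x 0<x * 1ℝ) (recip x 0<x * x) 1ℝ (*-monoˡ 1ℝ x (recip x 0<x) 0≤recip 1≤x)
      (≈⇒≤ (recip x 0<x * x) 1ℝ (≈-trans (recip x 0<x * x) (x * recip x 0<x) 1ℝ (pointwise⇒≈ (recip x 0<x * x) (x * recip x 0<x) λ i → ℚ.*-comm (seq (recip x 0<x) i) (seq x i)) *-recip)))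

-- Roots and rational powers

gridStep : ℝ
gridStep = mkℝ (λ i → grid i 1) λ δ 0<δ → let N , h = step-small (½ ℚ.* δ) (half-pos 0<δ) in
  N , λ i j Ni Nj → <+⇒∣-∣< (small δ 0<δ i j (h i Ni)) (small δ 0<δ j i (h j Nj))
  where
  small : ∀ δ → 0ℚ ℚ.< δ → ∀ i j → grid i 1 ℚ.≤ ½ ℚ.* δ → grid i 1 ℚ.< grid j 1 ℚ.+ δ
  small δ 0<δ i j le = begin-strict
    grid i 1             ≤⟨ le ⟩
    ½ ℚ.* δ              ≡⟨ ℚ.+-identityʳ _ ⟨
    ½ ℚ.* δ ℚ.+ 0ℚ       <⟨ ℚ.+-monoʳ-< (½ ℚ.* δ) (half-pos 0<δ) ⟩
    ½ ℚ.* δ ℚ.+ ½ ℚ.* δ  ≡⟨ halves δ ⟩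
    δ                    ≡⟨ ℚ.+-identityˡ δ ⟨
    0ℚ ℚ.+ δ             ≤⟨ ℚ.+-monoˡ-≤ δ (0≤grid j 1) ⟩
    grid j 1 ℚ.+ δ       ∎

-- The terms of `gridStep` are positive but tend to 0, so adding it to a root raises the terms
-- without raising the real number.
gridStep≤0 : gridStep ≤ 0ℝ
gridStep≤0 δ 0<δ with step-small δ 0<δ
... | N , h = N , λ i Ni → ℚ.≤-trans (h i Ni) (ℚ.≤-reflexive (sym (ℚ.+-identityˡ δ)))

seq-^ : ∀ x m i → seq (x ^ m) i ≡ seq x i ^ℚᴺ m
seq-^ x zero    i = refl
seq-^ x (suc m) i = cong (seq x i ℚ.*_) (seq-^ x m i)

≤-+ : ∀ p {δ} → 0ℚ ℚ.≤ δ → p ℚ.≤ p ℚ.+ δ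
≤-+ p {δ} 0≤δ = subst (ℚ._≤ p ℚ.+ δ) (ℚ.+-identityʳ p) (ℚ.+-monoʳ-≤ p 0≤δ)

1^ : ∀ m → 1ℚ ^ℚᴺ m ≡ 1ℚ
1^ zero    = refl
1^ (suc m) = trans (ℚ.*-identityˡ _) (1^ m)

-- For r < 1 the power of r would be at most 1, while p ≥ 1. The bound on p is what `2ℝ ≤ x` says
-- about late terms of x at tolerance 1.
1≤base : ∀ m p r → 0ℚ ℚ.≤ r → + 2 / 1 ℚ.≤ p ℚ.+ 1ℚ → p ℚ.< r ^ℚᴺ suc m → 1ℚ ℚ.≤ r
1≤base m p r 0≤r 2≤p+1 p<r^ = ℚ.≮⇒≥ λ r<1 → ℚ.<-irrefl refl (begin-strict
  1ℚ                 ≤⟨ ℚ.+-monoˡ-≤ (ℚ.- 1ℚ) 2≤p+1 ⟩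
  p ℚ.+ 1ℚ ℚ.- 1ℚ    ≡⟨ cancel p ⟩
  p                  <⟨ p<r^ ⟩
  r ^ℚᴺ suc m        ≤⟨ Rational.^-mono {r} {1ℚ} (suc m) 0≤r (ℚ.<⇒≤ r<1) ⟩
  1ℚ ^ℚᴺ suc m       ≡⟨ 1^ (suc m) ⟩
  1ℚ                 ∎)
  where
  open +-*-Solver
  cancel : ∀ a → a ℚ.+ 1ℚ ℚ.- 1ℚ ≡ a
  cancel = solve 1 (λ a → a :+ con 1ℚ :- con 1ℚ := a) refl

module _ (x : ℝ) (m : ℕ) where

  -- The terms of root x m are rounded down by less than those of gridStep.
  private
    roundedUp : ℝ
    roundedUp = root x m + gridStep

  roundedUp≤root : roundedUp ≤ root x m
  roundedUp≤root = ≤-trans roundedUp (root x m + 0ℝ) (root x m)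
    (+-mono (root x m) (root x m) gridStep 0ℝ (pointwise⇒≤ (root x m) (root x m) λ _ → ℚ.≤-refl) gridStep≤0)
    (pointwise⇒≤ (root x m + 0ℝ) (root x m) λ i → ℚ.≤-reflexive (ℚ.+-identityʳ (seq (root x m) i)))

  0≤roundedUp : ∀ i → 0ℚ ℚ.≤ seq roundedUp i
  0≤roundedUp i = ℚ.+-mono-≤ {0ℚ} {seq (root x m) i} {0ℚ} {grid i 1} (0≤grid i (rootNum (suc m) (seq x i) i (bound (seq x i) i))) (0≤grid i 1)

  -- Termwise, x lies below the power of the rounded-up root; the rounded-up root is in turn at most
  -- the root as a real number.
  x≤root^ : x ≤ root x m ^ suc m
  x≤root^ = ≤-trans x (roundedUp ^ suc m) (root x m ^ suc m)
    (pointwise⇒≤ x (roundedUp ^ suc m) λ i →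
      ℚ.≤-trans (ℚ.<⇒≤ (approxRoot-upper m (seq x i) i)) (ℚ.≤-reflexive (sym (seq-^ roundedUp (suc m) i))))
    (ℝ-Bounds.^-monoˡ roundedUp (root x m) (suc m) (pointwise⇒≤ 0ℝ roundedUp 0≤roundedUp) roundedUp≤root)

  1≤root : 2ℝ ≤ x → 1ℝ ≤ root x m
  1≤root 2≤x = ≤-trans 1ℝ roundedUp (root x m) 1≤roundedUp roundedUp≤root
    where
    1≤roundedUp : 1ℝ ≤ roundedUp
    1≤roundedUp δ 0<δ = let N , h = 2≤x 1ℚ (ℚ.positive⁻¹ 1ℚ) in N , λ i Ni →
      ℚ.≤-trans {1ℚ} {seq roundedUp i} {seq roundedUp i ℚ.+ δ}
        (1≤base m (seq x i) (seq roundedUp i) (0≤roundedUp i) (h i Ni) (approxRoot-upper m (seq x i) i))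
        (≤-+ (seq roundedUp i) (ℚ.<⇒≤ 0<δ))

^≤ratPow : ∀ x (2≤x : 2ℝ ≤ x) b p → ℚᵘ.mkℚᵘ (+ b) 0 ℚᵘ.≤ ℚ.toℚᵘ p → x ^ b ≤ ratPow x (2≤⇒0< {x} 2≤x) p
-- A negative `p` is not above the natural number `b`.
^≤ratPow x 2≤x b (mkℚ -[1+ a ] d _) (ℚᵘ.*≤* b≤p) =
  contradiction (ℤ.≤-trans b≤p (ℤ.≤-reflexive (ℤ.*-identityʳ -[1+ a ]))) λ le →
    ℤ.<⇒≱ (ℤ.<-≤-trans ℤ.-<+ (ℤ.≤-reflexive (ℤ.pos-* b (suc d)))) le
^≤ratPow x 2≤x b (mkℚ (+ a) d _) (ℚᵘ.*≤* b≤p) =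
  ℝ-Bounds.^-≤-^ x (root x d) b (suc d) a
    (≤-trans 0ℝ 2ℝ x (pointwise⇒≤ 0ℝ 2ℝ λ _ → ℚ.nonNegative⁻¹ (+ 2 ℚ./ 1)) 2≤x)
    (1≤root x d 2≤x) (x≤root^ x d) db≤a
  where
  db≤a : suc d ℕ.* b ℕ.≤ a
  db≤a = subst (ℕ._≤ a) (ℕ.*-comm b (suc d))
    (ℤ.drop‿+≤+ (subst₂ ℤ._≤_ (sym (ℤ.pos-* b (suc d))) (ℤ.*-identityʳ (+ a)) b≤p))

-- `_/_` and `_+ℚ_` reduce to lowest terms, which hides numerators and denominators. In unnormalised
-- rationals the claim is, after cross-multiplication, the hypothesis itself.
≤-quotient : ∀ b n g l → b ℕ.* suc g ℕ.≤ n ℕ.+ l ℕ.* suc g →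
             ℚᵘ.mkℚᵘ (+ b) 0 ℚᵘ.≤ ℚ.toℚᵘ (+ n / suc g +ℚ + l / 1)
≤-quotient b n g l le = ℚᵘ.≤-trans (ℚᵘ.*≤* crossed) (ℚᵘ.≤-reflexive (ℚᵘ.≃-sym (ℚᵘ.≃-trans
  (ℚ.toℚᵘ-homo-+ (+ n / suc g) (+ l / 1))
  (ℚᵘ.+-cong (ℚ.toℚᵘ-fromℚᵘ (ℚᵘ.mkℚᵘ (+ n) g)) (ℚ.toℚᵘ-fromℚᵘ (ℚᵘ.mkℚᵘ (+ l) 0))))))
  where
  crossed : + b ℤ.* + (suc g ℕ.* 1) ℤ.≤ (+ n ℤ.* + 1 ℤ.+ + l ℤ.* + suc g) ℤ.* + 1
  crossed rewrite ℕ.*-identityʳ g | ℤ.*-identityʳ (+ n ℤ.* + 1 ℤ.+ + l ℤ.* + suc g) | ℤ.*-identityʳ (+ n)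
    | sym (ℤ.pos-* b (suc g)) | sym (ℤ.pos-* l (suc g)) = ℤ.+≤+ le

-- The two bounds for real q and w

1≤q-1 : ∀ q → 2ℝ ≤ q → 1ℝ ≤ q - 1ℝ
1≤q-1 q 2≤q δ 0<δ = let N , h = 2≤q δ 0<δ in N , λ i Ni →
  ℚ.≤-trans (ℚ.+-monoˡ-≤ (ℚ.- 1ℚ) (h i Ni)) (ℚ.≤-reflexive (commute (seq q i) δ))
  where
  open +-*-Solver
  commute : ∀ a δ → a ℚ.+ δ ℚ.- 1ℚ ≡ a ℚ.- 1ℚ ℚ.+ δ
  commute = solve 2 (λ a δ → a :+ δ :- con 1ℚ := a :- con 1ℚ :+ δ) refl

q≈q-1+1 : ∀ q → q ≈ q - 1ℝ + 1ℝ
q≈q-1+1 q = pointwise⇒≈ q (q - 1ℝ + 1ℝ) λ i → cancel (seq q i)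
  where
  open +-*-Solver
  cancel : ∀ a → a ≡ a ℚ.- 1ℚ ℚ.+ 1ℚ
  cancel = solve 1 (λ a → a := a :- con 1ℚ :+ con 1ℚ) refl

module _ {n} (G : Graph n) (q w : ℝ) (0<q-1 : 0ℝ < q - 1ℝ) (1≤q-1 : 1ℝ ≤ q - 1ℝ) (0≤w : 0ℝ ≤ w) where

  private
    0≤q-1 : 0ℝ ≤ q - 1ℝ
    0≤q-1 = ≤-trans 0ℝ 1ℝ (q - 1ℝ) (pointwise⇒≤ 0ℝ 1ℝ λ _ → ℚ.nonNegative⁻¹ 1ℚ) 1≤q-1

  Z⁽²⁾≤Z : Z⁽²⁾ G q w 0<q-1 ≤ Z G q w
  Z⁽²⁾≤Z = ℝ-Bounds.Z⁽²⁾≤Z G q (q - 1ℝ) (recip (q - 1ℝ) 0<q-1) w (*-recip (q - 1ℝ) 0<q-1) 0≤q-1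
    (0≤recip (q - 1ℝ) 0<q-1) (recip≤1 (q - 1ℝ) 0<q-1 1≤q-1) (q≈q-1+1 q) 0≤w

  Z≤Q*Z⁽²⁾ : ∀ g Q → (∀ b → b ℕ.* g ℕ.≤ n ℕ.+ L G g ℕ.* g → q ^ b ≤ Q) → Z G q w ≤ Q * Z⁽²⁾ G q w 0<q-1
  Z≤Q*Z⁽²⁾ = ℝ-Bounds.Z≤Q*Z⁽²⁾ G q (q - 1ℝ) (recip (q - 1ℝ) 0<q-1) w (*-recip (q - 1ℝ) 0<q-1) 0≤q-1
    (0≤recip (q - 1ℝ) 0<q-1) (recip≤1 (q - 1ℝ) 0<q-1 1≤q-1) (q≈q-1+1 q) 0≤w

theorem2p4 : ∀ (n : ℕ) (G : Graph n) (g : ℕ) .{{_ : NonZero g}} (q w : ℝ) (2≤q : 2ℝ ≤ q) → 0ℝ ≤ w →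
    (Z⁽²⁾ G q w (2≤⇒0<-1 {q} 2≤q) ≤ Z G q w) ×
    (Z G q w ≤ ratPow q (2≤⇒0< {q} 2≤q) (+ n / g +ℚ + L G g / 1) * Z⁽²⁾ G q w (2≤⇒0<-1 {q} 2≤q))
theorem2p4 n G g@(suc g-1) q w 2≤q 0≤w =
  Z⁽²⁾≤Z G q w (2≤⇒0<-1 {q} 2≤q) (1≤q-1 q 2≤q) 0≤w ,
  Z≤Q*Z⁽²⁾ G q w (2≤⇒0<-1 {q} 2≤q) (1≤q-1 q 2≤q) 0≤w g (ratPow q (2≤⇒0< {q} 2≤q) (+ n / g +ℚ + L G g / 1))
    λ b le → ^≤ratPow q 2≤q b (+ n / g +ℚ + L G g / 1) (≤-quotient b n g-1 (L G g) le)
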